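{- Let $\ell\ge1$ and $a$ be integers with $\ell<a-1$. Then $$h_{\{ -\ell\},\{a\}}^{\{a+j\}}=\begin{cases} q^{\frac{j+\ell}{2}-1}(q-1) & j=\ell-2,\ell-4,\dots,2-\ell,\\ 1 & j=-\ell,\\ q^\ell & j=\ell.\end{cases}$$
   Context: $k$ is a finite field with $q$ elements, $\mathrm{char}(k)\neq2$. Let $G=\mathrm{GL}_2(k((z)))$, $K=\mathrm{GL}_2(k[[z]])$, $H=\mathrm{GL}_2(k((z^2)))$, with Haar measure on $G$ giving $K$ measure $1$. Here $\{ -\ell\}$ denotes $(0,-\ell)$ and $\{b\}$ denotes $(b,0)$ for $b>1$. $c_{\{ -\ell\}}$ is the characteristic function of $K\,\mathrm{diag}(z^{ -\ell},1)\,K$; for $b>1$, $\Pi^{\{b\}}=\begin{pmatrix}1&z\\0&z^b\end{pmatrix}$ and $d_{\{b\}}$ is the characteristic function of $K\Pi^{\{b\}}H$. The structure constant is $h_{\{ -\ell\},\{a\}}^{\{b\}}=(c_{\{ -\ell\}}\times d_{\{b\}})(\Pi^{\{a\}})$, where $(f\times g)(x)=\int_G g(y^{ -1}x)f(y)\,dy$; equivalently it is the coefficient of $d_{\{a\}}$ in $c_{\{ -\ell\}}\times d_{\{b\}}$. -}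

module Defs where

open import Algebra.Bundles using (CommutativeRing; Group; Monoid)
import Algebra.Properties.CommutativeSemigroup as CommutativeSemigroupProperties
import Algebra.Properties.Ring as RingProperties
open import Data.Fin.Base using (Fin)
open import Data.Integer.Base as ℤ using (ℤ; +_; -[1+_]; _⊖_; 0ℤ; 1ℤ)
import Data.Integer.Divisibility as ℤ
import Data.Integer.Properties as ℤ
import Data.Integer.Tactic.RingSolver as ℤ-Solver
open import Data.List.Base using (List)
open import Data.List.Relation.Unary.Any using (Any)
open import Data.Nat.Base using (ℕ; zero; suc)
open import Data.Product.Base using (Σ; ∃; _×_; _,_; proj₁; proj₂)
open import Data.Rational.Base as ℚ using (ℚ; 0ℚ; 1ℚ)
open import Data.Sum.Base using (_⊎_)
open import Function.Bundles using (Inverse)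
open import Level using (Level; _⊔_)
open import Relation.Binary.Bundles using (Setoid)
open import Relation.Binary.PropositionalEquality.Core as ≡ using (_≡_; _≢_)
import Relation.Binary.PropositionalEquality.Properties as ≡
import Relation.Binary.Reasoning.Setoid as SetoidReasoning
open import Relation.Nullary.Negation.Core using (¬_)

record IsFiniteField {c e : Level} (k : CommutativeRing c e) (q : ℕ) : Set (c ⊔ e) where
  open CommutativeRing k
  field
    1≉0         : ¬ (1# ≈ 0#)
    invertible  : ∀ x → ¬ (x ≈ 0#) → ∃ λ y → x * y ≈ 1#
    enumeration : Inverse setoid (≡.setoid (Fin q))

CharNot2 : {c e : Level} (k : CommutativeRing c e) → Set e
CharNot2 k = ¬ (1# + 1# ≈ 0#)
  where open CommutativeRing k

------------------------------------------------------------------------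
-- Formal Laurent series

module Laurent {c e : Level} (k : CommutativeRing c e) where

  private module k = CommutativeRing k
  open RingProperties k.ring using (-0#≈0#)

  open CommutativeSemigroupProperties k.+-commutativeSemigroup using (x∙yz≈y∙xz; interchange)

  Series : Set c
  Series = ℕ → k.Carrier

  infix 4 _≗_
  _≗_ : Series → Series → Set e
  a ≗ b = ∀ i → a i k.≈ b i

  tail : Series → Series
  tail a i = a (suc i)

  -- the Cauchy product, by the recursion ab = a₀b + z·(tail a)b
  conv : Series → Series → Series
  conv a b zero    = a 0 k.* b 0
  conv a b (suc i) = a 0 k.* b (suc i) k.+ conv (tail a) b i

  one : Series
  one zero    = k.1#
  one (suc _) = k.0#

  conv-cong : ∀ {a a′ b b′} → a ≗ a′ → b ≗ b′ → conv a b ≗ conv a′ b′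
  conv-cong p r zero    = k.*-cong (p 0) (r 0)
  conv-cong p r (suc i) =
    k.+-cong (k.*-cong (p 0) (r (suc i))) (conv-cong (λ j → p (suc j)) r i)

  conv-sucʳ : ∀ a b i → conv a b (suc i) k.≈ a (suc i) k.* b 0 k.+ conv a (tail b) i
  conv-sucʳ a b zero    = k.+-comm _ _
  conv-sucʳ a b (suc i) =
    k.trans (k.+-congˡ (conv-sucʳ (tail a) b i)) (x∙yz≈y∙xz _ _ _)

  conv-comm : ∀ a b → conv a b ≗ conv b a
  conv-comm a b zero    = k.*-comm _ _
  conv-comm a b (suc i) = k.trans
    (k.+-cong (k.*-comm _ _) (conv-comm (tail a) b i))
    (k.sym (conv-sucʳ b a i))

  conv-distribʳ : ∀ a b d → conv (λ i → a i k.+ b i) d ≗ (λ i → conv a d i k.+ conv b d i)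
  conv-distribʳ a b d zero    = k.distribʳ _ _ _
  conv-distribʳ a b d (suc i) = k.trans
    (k.+-cong (k.distribʳ _ _ _) (conv-distribʳ (tail a) (tail b) d i))
    (interchange _ _ _ _)

  conv-scaleˡ : ∀ x a b → conv (λ i → x k.* a i) b ≗ (λ i → x k.* conv a b i)
  conv-scaleˡ x a b zero    = k.*-assoc _ _ _
  conv-scaleˡ x a b (suc i) = k.trans
    (k.+-cong (k.*-assoc _ _ _) (conv-scaleˡ x (tail a) b i))
    (k.sym (k.distribˡ _ _ _))

  conv-assoc : ∀ a b d → conv (conv a b) d ≗ conv a (conv b d)
  conv-assoc a b d zero    = k.*-assoc _ _ _
  conv-assoc a b d (suc i) = begin
    (a 0 k.* b 0) k.* d (suc i) k.+ conv (λ j → a 0 k.* tail b j k.+ conv (tail a) b j) d i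
      ≈⟨ k.+-congˡ (conv-distribʳ (λ j → a 0 k.* tail b j) (conv (tail a) b) d i) ⟩
    (a 0 k.* b 0) k.* d (suc i) k.+
      (conv (λ j → a 0 k.* tail b j) d i k.+ conv (conv (tail a) b) d i)
      ≈⟨ k.+-congˡ (k.+-cong (conv-scaleˡ (a 0) (tail b) d i) (conv-assoc (tail a) b d i)) ⟩
    (a 0 k.* b 0) k.* d (suc i) k.+ (a 0 k.* conv (tail b) d i k.+ conv (tail a) (conv b d) i)
      ≈⟨ k.+-congʳ (k.*-assoc _ _ _) ⟩
    a 0 k.* (b 0 k.* d (suc i)) k.+ (a 0 k.* conv (tail b) d i k.+ conv (tail a) (conv b d) i)
      ≈⟨ k.+-assoc _ _ _ ⟨
    a 0 k.* (b 0 k.* d (suc i)) k.+ a 0 k.* conv (tail b) d i k.+ conv (tail a) (conv b d) i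
      ≈⟨ k.+-congʳ (k.distribˡ _ _ _) ⟨
    a 0 k.* (b 0 k.* d (suc i) k.+ conv (tail b) d i) k.+ conv (tail a) (conv b d) i
      ∎
    where open SetoidReasoning k.setoid

  conv-zeroˡ : ∀ b → conv (λ _ → k.0#) b ≗ (λ _ → k.0#)
  conv-zeroˡ b zero    = k.zeroˡ _
  conv-zeroˡ b (suc i) =
    k.trans (k.+-cong (k.zeroˡ _) (conv-zeroˡ b i)) (k.+-identityʳ _)

  conv-identityˡ : ∀ b → conv one b ≗ b
  conv-identityˡ b zero    = k.*-identityˡ _
  conv-identityˡ b (suc i) =
    k.trans (k.+-cong (k.*-identityˡ _) (conv-zeroˡ b i)) (k.+-identityʳ _)

  at : Series → ℤ → k.Carrier
  at a (+ i)    = a i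
  at a -[1+ _ ] = k.0#

  at-cong : ∀ {a b} → a ≗ b → ∀ n → at a n k.≈ at b n
  at-cong p (+ i)    = p i
  at-cong p -[1+ _ ] = k.refl

  at-+ : ∀ a b n → at (λ i → a i k.+ b i) n k.≈ at a n k.+ at b n
  at-+ a b (+ i)    = k.refl
  at-+ a b -[1+ _ ] = k.sym (k.+-identityʳ _)

  shift : ℕ → Series → Series
  shift m a i = at a (i ⊖ m)

  conv-shiftˡ : ∀ m a b → conv (shift m a) b ≗ shift m (conv a b)
  conv-shiftˡ zero    a b i       = k.refl
  conv-shiftˡ (suc m) a b zero    = k.zeroˡ _
  conv-shiftˡ (suc m) a b (suc i) = begin
    k.0# k.* b (suc i) k.+ conv (tail (shift (suc m) a)) b i
      ≈⟨ k.+-cong (k.zeroˡ _)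
           (conv-cong (λ j → k.reflexive (≡.cong (at a) (ℤ.[1+m]⊖[1+n]≡m⊖n j m))) (λ _ → k.refl) i) ⟩
    k.0# k.+ conv (shift m a) b i
      ≈⟨ k.+-identityˡ _ ⟩
    conv (shift m a) b i
      ≈⟨ conv-shiftˡ m a b i ⟩
    at (conv a b) (i ⊖ m)
      ≡⟨ ≡.cong (at (conv a b)) (ℤ.[1+m]⊖[1+n]≡m⊖n i m) ⟨
    shift (suc m) (conv a b) (suc i)
      ∎
    where open SetoidReasoning k.setoid

  at-shift : ∀ m a n → at (shift m a) n k.≈ at a (n ℤ.- + m)
  at-shift m       a (+ i)    = k.reflexive (≡.cong (at a) (≡.sym (ℤ.m-n≡m⊖n i m)))
  at-shift zero    a -[1+ i ] = k.refl
  at-shift (suc m) a -[1+ i ] = k.refl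

  -- z^ d · a stands for z^d (a₀ + a₁z + a₂z² + …); a₀ may vanish, so the
  -- representation is not unique and equality is equality of coefficients.
  record L : Set c where
    constructor z^_·_
    field
      ord    : ℤ
      series : Series

  open L public

  coeff : L → ℤ → k.Carrier
  coeff f n = at (series f) (n ℤ.- ord f)

  infix 4 _≈_
  record _≈_ (f g : L) : Set e where
    constructor coeffwise
    field
      coeff-≈ : ∀ n → coeff f n k.≈ coeff g n

  open _≈_ public

  zpow : ℤ → L
  zpow m = z^ m · one

  infixl 6 _+_
  infixl 7 _*_
  infix  8 -_

  _+_ : L → L → L
  f + g = z^ d · λ i → coeff f (d ℤ.+ + i) k.+ coeff g (d ℤ.+ + i)
    where d = ord f ℤ.⊓ ord g

  _*_ : L → L → L
  f * g = z^ (ord f ℤ.+ ord g) · conv (series f) (series g)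

  -_ : L → L
  - f = z^ (ord f) · λ i → k.- series f i

  private
    ℤ₁ : ∀ n d → n ≡ d ℤ.+ (n ℤ.- d)
    ℤ₁ = ℤ-Solver.solve-∀

    ℤ₂ : ∀ n d m → n ℤ.- d ℤ.- m ≡ n ℤ.- (d ℤ.+ m)
    ℤ₂ = ℤ-Solver.solve-∀

    ℤ₃ : ∀ d m e → d ℤ.+ e ℤ.+ m ≡ d ℤ.+ m ℤ.+ e
    ℤ₃ = ℤ-Solver.solve-∀

    ℤ₄ : ∀ n d o → (n ℤ.- o) ≡ (n ℤ.- d) ℤ.- (o ℤ.- d)
    ℤ₄ = ℤ-Solver.solve-∀

  diff : ∀ {d o} → d ℤ.≤ o → ∃ λ m → o ℤ.- d ≡ + m
  diff {d} {o} p with o ℤ.- d | ℤ.i≤j⇒0≤j-i p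
  ... | + m | _ = m , ≡.refl

  coeff-below : ∀ f {d} → d ℤ.≤ ord f → ∀ n i → n ℤ.- d ≡ -[1+ i ] → coeff f n k.≈ k.0#
  coeff-below f {d} p n i eq with diff p
  ... | m , r = k.trans
    (k.reflexive (≡.cong (at (series f)) (≡.trans (ℤ₄ n d (ord f)) (≡.cong₂ ℤ._-_ eq r))))
    (k.sym (at-shift m (series f) -[1+ i ]))

  coeff-+ : ∀ f g n → coeff (f + g) n k.≈ coeff f n k.+ coeff g n
  coeff-+ f g n with n ℤ.- (ord f ℤ.⊓ ord g) in eq
  ... | + i      = k.reflexive (≡.cong (λ m → coeff f m k.+ coeff g m)
                     (≡.sym (≡.trans (ℤ₁ n (ord f ℤ.⊓ ord g)) (≡.cong (λ m → (ord f ℤ.⊓ ord g) ℤ.+ m) eq))))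
  ... | -[1+ i ] = k.sym (k.trans
                     (k.+-cong (coeff-below f (ℤ.i⊓j≤i (ord f) (ord g)) n i eq)
                               (coeff-below g (ℤ.i⊓j≤j (ord f) (ord g)) n i eq))
                     (k.+-identityʳ _))

  coeff-neg : ∀ f n → coeff (- f) n k.≈ k.- coeff f n
  coeff-neg f n with n ℤ.- ord f
  ... | + i      = k.refl
  ... | -[1+ i ] = k.sym -0#≈0#

  setoid : Setoid c e
  setoid = record
    { Carrier = L
    ; _≈_ = _≈_
    ; isEquivalence = record
      { refl  = coeffwise λ n → k.refl
      ; sym   = λ p → coeffwise λ n → k.sym (coeff-≈ p n)
      ; trans = λ p r → coeffwise λ n → k.trans (coeff-≈ p n) (coeff-≈ r n)
      }
    }

  private module ≈ = Setoid setoid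

  z^-cong : ∀ {d d′ a a′} → d ≡ d′ → a ≗ a′ → (z^ d · a) ≈ (z^ d′ · a′)
  z^-cong {d} ≡.refl p = coeffwise λ n → at-cong p (n ℤ.- d)

  z^-congˡ : ∀ {d d′} a → d ≡ d′ → (z^ d · a) ≈ (z^ d′ · a)
  z^-congˡ a ≡.refl = ≈.refl

  z^-congʳ : ∀ d {a a′} → a ≗ a′ → (z^ d · a) ≈ (z^ d · a′)
  z^-congʳ d p = coeffwise λ n → at-cong p (n ℤ.- d)

  z^-injective : ∀ {d a b} → (z^ d · a) ≈ (z^ d · b) → a ≗ b
  z^-injective {d} {a} {b} p i =
    ≡.subst (λ m → at a m k.≈ at b m) (ℤ₅ d (+ i)) (coeff-≈ p (d ℤ.+ + i))
    where
    ℤ₅ : ∀ d i → d ℤ.+ i ℤ.- d ≡ i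
    ℤ₅ = ℤ-Solver.solve-∀

  z^-shift : ∀ d m a → (z^ d · shift m a) ≈ (z^ (d ℤ.+ + m) · a)
  z^-shift d m a = coeffwise λ n →
    k.trans (at-shift m a (n ℤ.- d)) (k.reflexive (≡.cong (at a) (ℤ₂ n d (+ m))))

  -- f rewritten with a smaller leading exponent d
  lower : ∀ f d → d ℤ.≤ ord f → L
  lower f d p = z^ d · shift (proj₁ (diff p)) (series f)

  ord-lower : ∀ f {d} (p : d ℤ.≤ ord f) → d ℤ.+ + proj₁ (diff p) ≡ ord f
  ord-lower f {d} p =
    ≡.trans (≡.cong (λ m → d ℤ.+ m) (≡.sym (proj₂ (diff p)))) (≡.sym (ℤ₁ (ord f) d))

  lower-≈ : ∀ f {d} (p : d ℤ.≤ ord f) → lower f d p ≈ f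
  lower-≈ f {d} p =
    ≈.trans (z^-shift d (proj₁ (diff p)) (series f)) (z^-congˡ (series f) (ord-lower f p))

  lower-* : ∀ f g {d} (p : d ℤ.≤ ord f) → lower f d p * g ≈ f * g
  lower-* f g {d} p = begin
    lower f d p * g
      ≈⟨ z^-congʳ (d ℤ.+ ord g) (conv-shiftˡ m (series f) (series g)) ⟩
    z^ (d ℤ.+ ord g) · shift m (conv (series f) (series g))
      ≈⟨ z^-shift (d ℤ.+ ord g) m (conv (series f) (series g)) ⟩
    z^ (d ℤ.+ ord g ℤ.+ + m) · conv (series f) (series g)
      ≈⟨ z^-congˡ _ (≡.trans (ℤ₃ d (+ m) (ord g)) (≡.cong (λ x → x ℤ.+ ord g) (ord-lower f p))) ⟩
    f * g
      ∎
    where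
    open SetoidReasoning setoid
    m = proj₁ (diff p)

  *-comm : ∀ f g → f * g ≈ g * f
  *-comm f g = z^-cong (ℤ.+-comm (ord f) (ord g)) (conv-comm (series f) (series g))

  *-congʳ : ∀ {f f′} g → f ≈ f′ → f * g ≈ f′ * g
  *-congʳ {f} {f′} g p = begin
    f * g             ≈⟨ lower-* f g l ⟨
    lower f d l * g   ≈⟨ z^-congʳ (d ℤ.+ ord g) (conv-cong (z^-injective eq) (λ _ → k.refl)) ⟩
    lower f′ d l′ * g ≈⟨ lower-* f′ g l′ ⟩
    f′ * g            ∎
    where
    open SetoidReasoning setoid
    d  = ord f ℤ.⊓ ord f′
    l  = ℤ.i⊓j≤i (ord f) (ord f′)
    l′ = ℤ.i⊓j≤j (ord f) (ord f′)
    eq : lower f d l ≈ lower f′ d l′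
    eq = ≈.trans (lower-≈ f l) (≈.trans p (≈.sym (lower-≈ f′ l′)))

  *-cong : ∀ {f f′ g g′} → f ≈ f′ → g ≈ g′ → f * g ≈ f′ * g′
  *-cong {f} {f′} {g} {g′} p r = begin
    f * g   ≈⟨ *-congʳ g p ⟩
    f′ * g  ≈⟨ *-comm f′ g ⟩
    g * f′  ≈⟨ *-congʳ f′ r ⟩
    g′ * f′ ≈⟨ *-comm g′ f′ ⟩
    f′ * g′ ∎
    where open SetoidReasoning setoid

  +-cong : ∀ {f f′ g g′} → f ≈ f′ → g ≈ g′ → f + g ≈ f′ + g′
  +-cong {f} {f′} {g} {g′} p r = coeffwise λ n → k.trans (coeff-+ f g n)
    (k.trans (k.+-cong (coeff-≈ p n) (coeff-≈ r n)) (k.sym (coeff-+ f′ g′ n)))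

  z^-+ : ∀ d a b → (z^ d · a) + (z^ d · b) ≈ z^ d · (λ i → a i k.+ b i)
  z^-+ d a b = coeffwise λ n →
    k.trans (coeff-+ (z^ d · a) (z^ d · b) n) (k.sym (at-+ a b (n ℤ.- d)))

  *-distribʳ : ∀ h f g → (f + g) * h ≈ f * h + g * h
  *-distribʳ h f g = begin
    (f + g) * h
      ≈⟨ *-congʳ h (≈.trans (+-cong (≈.sym (lower-≈ f l)) (≈.sym (lower-≈ g l′))) (z^-+ d a b)) ⟩
    (z^ d · (λ i → a i k.+ b i)) * h
      ≈⟨ z^-congʳ (d ℤ.+ ord h) (conv-distribʳ a b (series h)) ⟩
    z^ (d ℤ.+ ord h) · (λ i → conv a (series h) i k.+ conv b (series h) i)
      ≈⟨ z^-+ (d ℤ.+ ord h) (conv a (series h)) (conv b (series h)) ⟨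
    lower f d l * h + lower g d l′ * h
      ≈⟨ +-cong (lower-* f h l) (lower-* g h l′) ⟩
    f * h + g * h
      ∎
    where
    open SetoidReasoning setoid
    d  = ord f ℤ.⊓ ord g
    l  = ℤ.i⊓j≤i (ord f) (ord g)
    l′ = ℤ.i⊓j≤j (ord f) (ord g)
    a  = series (lower f d l)
    b  = series (lower g d l′)

  0L : L
  0L = z^ 0ℤ · λ _ → k.0#

  coeff-0L : ∀ n → coeff 0L n k.≈ k.0#
  coeff-0L n with n ℤ.- 0ℤ
  ... | + _      = k.refl
  ... | -[1+ _ ] = k.refl

  zpow-+ : ∀ m n → zpow m * zpow n ≈ zpow (m ℤ.+ n)
  zpow-+ m n = z^-congʳ (m ℤ.+ n) (conv-identityˡ one)

  ring : CommutativeRing c e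
  ring = record
    { Carrier = L
    ; _≈_ = _≈_
    ; _+_ = _+_
    ; _*_ = _*_
    ; -_ = -_
    ; 0# = 0L
    ; 1# = zpow 0ℤ
    ; isCommutativeRing = record
      { isRing = record
        { +-isAbelianGroup = record
          { isGroup = record
            { isMonoid = record
              { isSemigroup = record
                { isMagma = record { isEquivalence = ≈.isEquivalence ; ∙-cong = +-cong }
                ; assoc = λ f g h → coeffwise λ n → k.trans (coeff-+ (f + g) h n) (k.trans
                    (k.+-congʳ (coeff-+ f g n)) (k.trans (k.+-assoc _ _ _) (k.sym (k.trans
                    (coeff-+ f (g + h) n) (k.+-congˡ (coeff-+ g h n))))))
                }
              ; identity = idˡ , λ f → ≈.trans (+-comm f 0L) (idˡ f)
              }
            ; inverse = invˡ , λ f → ≈.trans (+-comm f (- f)) (invˡ f)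
            ; ⁻¹-cong = λ {f} {g} p → coeffwise λ n → k.trans (coeff-neg f n)
                (k.trans (k.-‿cong (coeff-≈ p n)) (k.sym (coeff-neg g n)))
            }
          ; comm = +-comm
          }
        ; *-cong = *-cong
        ; *-assoc = λ f g h → z^-cong (ℤ.+-assoc (ord f) (ord g) (ord h))
            (conv-assoc (series f) (series g) (series h))
        ; *-identity = *-idˡ , λ f → ≈.trans (*-comm f (zpow 0ℤ)) (*-idˡ f)
        ; distrib = (λ f g h → ≈.trans (*-comm f (g + h)) (≈.trans (*-distribʳ f g h)
              (+-cong (*-comm g f) (*-comm h f))))
            , *-distribʳ
        }
      ; *-comm = *-comm
      }
    }
    where
    +-comm : ∀ f g → f + g ≈ g + f
    +-comm f g = coeffwise λ n →
      k.trans (coeff-+ f g n) (k.trans (k.+-comm _ _) (k.sym (coeff-+ g f n)))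

    idˡ : ∀ f → 0L + f ≈ f
    idˡ f = coeffwise λ n →
      k.trans (coeff-+ 0L f n) (k.trans (k.+-congʳ (coeff-0L n)) (k.+-identityˡ _))

    invˡ : ∀ f → - f + f ≈ 0L
    invˡ f = coeffwise λ n → k.trans (coeff-+ (- f) f n) (k.trans (k.+-congʳ (coeff-neg f n))
      (k.trans (k.-‿inverseˡ _) (k.sym (coeff-0L n))))

    *-idˡ : ∀ f → zpow 0ℤ * f ≈ f
    *-idˡ f = z^-cong (ℤ.+-identityˡ (ord f)) (conv-identityˡ (series f))

  -- z^m k[[z]]; in particular k[[z]] is InPower 0ℤ
  InPower : ℤ → L → Set e
  InPower m f = ∀ n → n ℤ.< m → coeff f n k.≈ k.0#

  -- k((z²))
  InSquares : L → Set e
  InSquares f = ∀ n → ¬ (+ 2 ℤ.∣ n) → coeff f n k.≈ k.0#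

------------------------------------------------------------------------
-- GL₂

module Units {c e : Level} (M : Monoid c e) where

  open Monoid M
  open SetoidReasoning setoid

  record Unit : Set (c ⊔ e) where
    no-eta-equality
    field
      val inv      : Carrier
      rightInverse : val ∙ inv ≈ ε
      leftInverse  : inv ∙ val ≈ ε

  open Unit public

  private
    cancel : ∀ {x y u v} → x ∙ y ≈ ε → u ∙ v ≈ ε → (u ∙ x) ∙ (y ∙ v) ≈ ε
    cancel {x} {y} {u} {v} p r = begin
      (u ∙ x) ∙ (y ∙ v) ≈⟨ assoc _ _ _ ⟩
      u ∙ (x ∙ (y ∙ v)) ≈⟨ ∙-congˡ (assoc _ _ _) ⟨
      u ∙ ((x ∙ y) ∙ v) ≈⟨ ∙-congˡ (∙-congʳ p) ⟩
      u ∙ (ε ∙ v)       ≈⟨ ∙-congˡ (identityˡ _) ⟩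
      u ∙ v             ≈⟨ r ⟩
      ε                 ∎

  group : Group (c ⊔ e) e
  group = record
    { Carrier = Unit
    ; _≈_ = λ g h → val g ≈ val h
    ; _∙_ = λ g h → record
      { val = val g ∙ val h
      ; inv = inv h ∙ inv g
      ; rightInverse = cancel (rightInverse h) (rightInverse g)
      ; leftInverse  = cancel (leftInverse g) (leftInverse h)
      }
    ; ε = record
      { val = ε ; inv = ε ; rightInverse = identityˡ ε ; leftInverse = identityˡ ε }
    ; _⁻¹ = λ g → record
      { val = inv g ; inv = val g ; rightInverse = leftInverse g ; leftInverse = rightInverse g }
    ; isGroup = record
      { isMonoid = record
        { isSemigroup = record
          { isMagma = record
            { isEquivalence = record { refl = refl ; sym = sym ; trans = trans }
            ; ∙-cong = ∙-cong
            }
          ; assoc = λ g h i → assoc _ _ _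
          }
        ; identity = (λ g → identityˡ _) , (λ g → identityʳ _)
        }
      ; inverse = leftInverse , rightInverse
      ; ⁻¹-cong = λ {g} {h} p → begin
          inv g                   ≈⟨ identityʳ _ ⟨
          inv g ∙ ε               ≈⟨ ∙-congˡ (rightInverse h) ⟨
          inv g ∙ (val h ∙ inv h) ≈⟨ ∙-congˡ (∙-congʳ p) ⟨
          inv g ∙ (val g ∙ inv h) ≈⟨ assoc _ _ _ ⟨
          (inv g ∙ val g) ∙ inv h ≈⟨ ∙-congʳ (leftInverse g) ⟩
          ε ∙ inv h               ≈⟨ identityˡ _ ⟩
          inv h                   ∎
      }
    }

module Matrices {c e : Level} (R : CommutativeRing c e) where

  private module R = CommutativeRing R
  open RingProperties R.ring using (-‿distribˡ-*; -‿distribʳ-*)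

  open CommutativeSemigroupProperties R.+-commutativeSemigroup using (interchange)
  open CommutativeSemigroupProperties R.*-commutativeSemigroup using (x∙yz≈xy∙z)

  record Mat₂ : Set c where
    constructor mat
    field
      e₁₁ e₁₂ e₂₁ e₂₂ : R.Carrier

  open Mat₂ public

  record Entrywise {p : Level} (P : R.Carrier → R.Carrier → Set p) (A B : Mat₂) : Set p where
    constructor entrywise
    field
      p₁₁ : P (e₁₁ A) (e₁₁ B)
      p₁₂ : P (e₁₂ A) (e₁₂ B)
      p₂₁ : P (e₂₁ A) (e₂₁ B)
      p₂₂ : P (e₂₂ A) (e₂₂ B)

  open Entrywise public

  _·_ : Mat₂ → Mat₂ → Mat₂
  mat a b c d · mat a′ b′ c′ d′ = mat
    (a R.* a′ R.+ b R.* c′) (a R.* b′ R.+ b R.* d′)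
    (c R.* a′ R.+ d R.* c′) (c R.* b′ R.+ d R.* d′)

  I : Mat₂
  I = mat R.1# R.0# R.0# R.1#

  monoid : Monoid c e
  monoid = record
    { Carrier = Mat₂
    ; _≈_ = Entrywise R._≈_
    ; _∙_ = _·_
    ; ε = I
    ; isMonoid = record
      { isSemigroup = record
        { isMagma = record
          { isEquivalence = record
            { refl  = entrywise R.refl R.refl R.refl R.refl
            ; sym   = λ p → entrywise (R.sym (p₁₁ p)) (R.sym (p₁₂ p)) (R.sym (p₂₁ p)) (R.sym (p₂₂ p))
            ; trans = λ p r → entrywise (R.trans (p₁₁ p) (p₁₁ r)) (R.trans (p₁₂ p) (p₁₂ r))
                                        (R.trans (p₂₁ p) (p₂₁ r)) (R.trans (p₂₂ p) (p₂₂ r))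
            }
          ; ∙-cong = λ p r → entrywise
              (R.+-cong (R.*-cong (p₁₁ p) (p₁₁ r)) (R.*-cong (p₁₂ p) (p₂₁ r)))
              (R.+-cong (R.*-cong (p₁₁ p) (p₁₂ r)) (R.*-cong (p₁₂ p) (p₂₂ r)))
              (R.+-cong (R.*-cong (p₂₁ p) (p₁₁ r)) (R.*-cong (p₂₂ p) (p₂₁ r)))
              (R.+-cong (R.*-cong (p₂₁ p) (p₁₂ r)) (R.*-cong (p₂₂ p) (p₂₂ r)))
          }
        ; assoc = λ A B C → entrywise
            (assoc₂ _ _ _ _ _ _ _ _) (assoc₂ _ _ _ _ _ _ _ _)
            (assoc₂ _ _ _ _ _ _ _ _) (assoc₂ _ _ _ _ _ _ _ _)
        }
      ; identity =
          (λ A → entrywise (idˡ₁ _ _) (idˡ₁ _ _) (idˡ₂ _ _) (idˡ₂ _ _)) ,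
          (λ A → entrywise (idʳ₁ _ _) (idʳ₂ _ _) (idʳ₁ _ _) (idʳ₂ _ _))
      }
    }
    where
    assoc₂ : ∀ x₁ x₂ y₁₁ y₁₂ y₂₁ y₂₂ u₁ u₂ →
      (x₁ R.* y₁₁ R.+ x₂ R.* y₂₁) R.* u₁ R.+ (x₁ R.* y₁₂ R.+ x₂ R.* y₂₂) R.* u₂
        R.≈ x₁ R.* (y₁₁ R.* u₁ R.+ y₁₂ R.* u₂) R.+ x₂ R.* (y₂₁ R.* u₁ R.+ y₂₂ R.* u₂)
    assoc₂ x₁ x₂ y₁₁ y₁₂ y₂₁ y₂₂ u₁ u₂ = begin
      (x₁ R.* y₁₁ R.+ x₂ R.* y₂₁) R.* u₁ R.+ (x₁ R.* y₁₂ R.+ x₂ R.* y₂₂) R.* u₂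
        ≈⟨ R.+-cong (expand y₁₁ y₂₁ u₁) (expand y₁₂ y₂₂ u₂) ⟩
      (x₁ R.* (y₁₁ R.* u₁) R.+ x₂ R.* (y₂₁ R.* u₁)) R.+
        (x₁ R.* (y₁₂ R.* u₂) R.+ x₂ R.* (y₂₂ R.* u₂))
        ≈⟨ interchange _ _ _ _ ⟩
      (x₁ R.* (y₁₁ R.* u₁) R.+ x₁ R.* (y₁₂ R.* u₂)) R.+
        (x₂ R.* (y₂₁ R.* u₁) R.+ x₂ R.* (y₂₂ R.* u₂))
        ≈⟨ R.+-cong (R.distribˡ _ _ _) (R.distribˡ _ _ _) ⟨
      x₁ R.* (y₁₁ R.* u₁ R.+ y₁₂ R.* u₂) R.+ x₂ R.* (y₂₁ R.* u₁ R.+ y₂₂ R.* u₂)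
        ∎
      where
      open SetoidReasoning R.setoid
      expand : ∀ y y′ u → (x₁ R.* y R.+ x₂ R.* y′) R.* u R.≈ x₁ R.* (y R.* u) R.+ x₂ R.* (y′ R.* u)
      expand y y′ u = R.trans (R.distribʳ _ _ _) (R.+-cong (R.*-assoc _ _ _) (R.*-assoc _ _ _))

    idˡ₁ : ∀ x y → R.1# R.* x R.+ R.0# R.* y R.≈ x
    idˡ₁ x y = R.trans (R.+-cong (R.*-identityˡ x) (R.zeroˡ y)) (R.+-identityʳ x)

    idˡ₂ : ∀ x y → R.0# R.* x R.+ R.1# R.* y R.≈ y
    idˡ₂ x y = R.trans (R.+-cong (R.zeroˡ x) (R.*-identityˡ y)) (R.+-identityˡ y)

    idʳ₁ : ∀ x y → x R.* R.1# R.+ y R.* R.0# R.≈ x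
    idʳ₁ x y = R.trans (R.+-cong (R.*-identityʳ x) (R.zeroʳ y)) (R.+-identityʳ x)

    idʳ₂ : ∀ x y → x R.* R.0# R.+ y R.* R.1# R.≈ y
    idʳ₂ x y = R.trans (R.+-cong (R.zeroʳ x) (R.*-identityʳ y)) (R.+-identityˡ y)

  open Units monoid public

  upper : ∀ {u u⁻¹ w w⁻¹} → u R.* u⁻¹ R.≈ R.1# → R.Carrier → w R.* w⁻¹ R.≈ R.1# → Unit
  upper {u} {u⁻¹} {w} {w⁻¹} p v r = record
    { val = mat u v R.0# w
    ; inv = mat u⁻¹ (R.- (u⁻¹ R.* v R.* w⁻¹)) R.0# w⁻¹
    ; rightInverse = entrywise
        (R.trans (diag₁ u u⁻¹ v) p)
        (R.trans (off₁ u u⁻¹ v w⁻¹) (collapse (v R.* w⁻¹) p))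
        (low u⁻¹ w)
        (R.trans (diag₂ w w⁻¹ _) r)
    ; leftInverse = entrywise
        (R.trans (diag₁ u⁻¹ u _) (R.trans (R.*-comm _ _) p))
        (R.trans (off₂ u⁻¹ v w w⁻¹) (collapse (u⁻¹ R.* v) r))
        (low u w⁻¹)
        (R.trans (diag₂ w⁻¹ w v) (R.trans (R.*-comm _ _) r))
    }
    where
    diag₁ : ∀ x y t → x R.* y R.+ t R.* R.0# R.≈ x R.* y
    diag₁ x y t = R.trans (R.+-congˡ (R.zeroʳ t)) (R.+-identityʳ _)

    diag₂ : ∀ x y t → R.0# R.* t R.+ x R.* y R.≈ x R.* y
    diag₂ x y t = R.trans (R.+-congʳ (R.zeroˡ t)) (R.+-identityˡ _)

    low : ∀ x y → R.0# R.* x R.+ y R.* R.0# R.≈ R.0#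
    low x y = R.trans (R.+-cong (R.zeroˡ x) (R.zeroʳ y)) (R.+-identityˡ _)

    off₁ : ∀ u u′ v w → u R.* (R.- (u′ R.* v R.* w)) R.+ v R.* w
      R.≈ R.- ((u R.* u′) R.* (v R.* w)) R.+ v R.* w
    off₁ u u′ v w = R.+-congʳ (R.trans (R.sym (-‿distribʳ-* u (u′ R.* v R.* w)))
      (R.-‿cong (R.trans (R.*-congˡ (R.*-assoc _ _ _)) (x∙yz≈xy∙z u u′ (v R.* w)))))

    off₂ : ∀ u v w w′ → u R.* v R.+ (R.- (u R.* v R.* w′)) R.* w
      R.≈ R.- ((w R.* w′) R.* (u R.* v)) R.+ u R.* v
    off₂ u v w w′ = R.trans (R.+-comm _ _)
      (R.+-congʳ (R.trans (R.sym (-‿distribˡ-* (u R.* v R.* w′) w))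
        (R.-‿cong (R.trans (R.*-assoc _ _ _)
          (R.trans (R.*-comm _ _) (R.*-congʳ (R.*-comm _ _)))))))

    collapse : ∀ {x} y → x R.≈ R.1# → R.- (x R.* y) R.+ y R.≈ R.0#
    collapse y p = R.trans
      (R.+-congʳ (R.-‿cong (R.trans (R.*-congʳ p) (R.*-identityˡ y)))) (R.-‿inverseˡ y)

  -- For P the carrier of a subring: g ∈ GL₂(P), i.e. g and g⁻¹ have entries in P.
  GL₂[_] : {p : Level} → (R.Carrier → Set p) → Unit → Set p
  GL₂[ P ] g = Over (val g) × Over (inv g)
    where
    Over : Mat₂ → Set _
    Over A = Entrywise (λ x _ → P x) A A

------------------------------------------------------------------------
-- Haar integration

-- 𝓖 is a locally compact group, K a compact open subgroup and U a sequence of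
-- compact open subgroups of K forming a basis of neighbourhoods of the identity.
module Haar {c e p : Level} (𝓖 : Group c e)
  (K : Group.Carrier 𝓖 → Set p) (U : ℕ → Group.Carrier 𝓖 → Set p) where

  open Group 𝓖 using (_∙_; _⁻¹) renaming (Carrier to G)

  -- The locally constant functions with compact support.  Compactness makes
  -- local constancy uniform and lets finitely many cosets of K cover the support.
  record TestFunction (f : G → ℚ) : Set (c ⊔ p) where
    field
      level              : ℕ
      locallyConstant    : ∀ g h → U level (g ⁻¹ ∙ h) → f g ≡ f h
      support            : List G
      compactlySupported : ∀ g → f g ≢ 0ℚ → Any (λ s → K (s ⁻¹ ∙ g)) support

  IsCharacteristic : {r : Level} → (G → Set r) → (G → ℚ) → Set (c ⊔ r)
  IsCharacteristic S f = ∀ g → (S g × f g ≡ 1ℚ) ⊎ (¬ S g × f g ≡ 0ℚ)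

  -- Haar measure μ is taken as the functional f ↦ ∫ f dμ on test functions, which
  -- determines it; μ(K) = 1 makes the integral of a ℚ-valued function rational.
  record HaarIntegral : Set (c ⊔ p) where
    field
      ∫             : (f : G → ℚ) → TestFunction f → ℚ
      cong          : {f g : G → ℚ} (tf : TestFunction f) (tg : TestFunction g) →
                      (∀ y → f y ≡ g y) → ∫ f tf ≡ ∫ g tg
      additive      : {f g : G → ℚ} (tf : TestFunction f) (tg : TestFunction g)
                      (t : TestFunction (λ y → f y ℚ.+ g y)) →
                      ∫ (λ y → f y ℚ.+ g y) t ≡ ∫ f tf ℚ.+ ∫ g tg
      homogeneous   : (r : ℚ) {f : G → ℚ} (tf : TestFunction f)
                      (t : TestFunction (λ y → r ℚ.* f y)) →
                      ∫ (λ y → r ℚ.* f y) t ≡ r ℚ.* ∫ f tf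
      positive      : {f : G → ℚ} (tf : TestFunction f) → (∀ y → 0ℚ ℚ.≤ f y) → 0ℚ ℚ.≤ ∫ f tf
      leftInvariant : (x : G) {f : G → ℚ} (tf : TestFunction f)
                      (t : TestFunction (λ y → f (x ∙ y))) →
                      ∫ (λ y → f (x ∙ y)) t ≡ ∫ f tf
      normalised    : {f : G → ℚ} (tf : TestFunction f) → IsCharacteristic K f → ∫ f tf ≡ 1ℚ

  open HaarIntegral public

  -- ∫ f dμ exists and equals r.
  HasIntegral : HaarIntegral → (G → ℚ) → ℚ → Set (c ⊔ p)
  HasIntegral μ f r = Σ (TestFunction f) λ t → ∫ μ f t ≡ r

  -- (f × g)(x) = r
  ConvolutionAt : HaarIntegral → (f g : G → ℚ) → G → ℚ → Set (c ⊔ p)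
  ConvolutionAt μ f g x r = HasIntegral μ (λ y → g (y ⁻¹ ∙ x) ℚ.* f y) r

------------------------------------------------------------------------
-- GL₂(k((z))) and the structure constants

module GL₂k⟮⟮z⟯⟯ {c e : Level} (k : CommutativeRing c e) where

  open Laurent k using (L; zpow; zpow-+; InPower; InSquares) renaming (ring to k⟮⟮z⟯⟯)
  open Matrices k⟮⟮z⟯⟯ using (val; upper; GL₂[_]; Entrywise; I; group)

  private module R = CommutativeRing k⟮⟮z⟯⟯

  open Group group public using (_≈_; _∙_; _⁻¹) renaming (Carrier to G)

  K : G → Set e
  K = GL₂[ InPower 0ℤ ]

  H : G → Set e
  H = GL₂[ InSquares ]

  -- the principal congruence subgroup of level n
  K[_] : ℕ → G → Set e
  K[ n ] g = K g × Entrywise (λ x y → InPower (+ n) (x R.- y)) (val g) I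

  open Haar group K K[_] public

  -- the double coset A x B
  _⟨_⟩_ : (G → Set e) → G → (G → Set e) → G → Set (c ⊔ e)
  (A ⟨ x ⟩ B) g = ∃ λ u → ∃ λ v → A u × B v × g ≈ u ∙ x ∙ v

  zpow-inverse : ∀ m → zpow m R.* zpow (ℤ.- m) R.≈ R.1#
  zpow-inverse m = R.trans (zpow-+ m (ℤ.- m)) (R.reflexive (≡.cong zpow (ℤ.+-inverseʳ m)))

  -- (z^m v; 0 z^n)
  triangular : ℤ → L → ℤ → G
  triangular m v n = upper {zpow m} {zpow (ℤ.- m)} {zpow n} {zpow (ℤ.- n)}
    (zpow-inverse m) v (zpow-inverse n)

  diag : ℤ → ℤ → G
  diag m n = triangular m R.0# n

  -- Π b = (1 z; 0 z^b), as zpow 0ℤ is the unit of k((z)).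
  Π : ℤ → G
  Π b = triangular 0ℤ (zpow 1ℤ) b

  -- h is the structure constant (c × d)(Π a), where c and d are the characteristic
  -- functions of K diag(z^{-ℓ}, 1) K and K Π b H.  They are quantified over because
  -- a ℚ-valued characteristic function carries a decision of membership; any two
  -- characteristic functions of the same set agree pointwise.
  StructureConstant : HaarIntegral → (ℓ a b : ℤ) → ℚ → Set (c ⊔ e)
  StructureConstant μ ℓ a b h = ∀ (c d : G → ℚ) →
    IsCharacteristic (K ⟨ diag (ℤ.- ℓ) 0ℤ ⟩ K) c →
    IsCharacteristic (K ⟨ Π b ⟩ H) d →
    ConvolutionAt μ c d (Π a) h

-- The left cosets of K in K diag(z^{-ℓ}, 1) K are the ρ⁻¹ K, where ρ = (z^t, -v; 0, z^i)
-- with t + i = ℓ and v ∈ k[[z]] modulo z^i, v being a unit unless t = 0 or i = 0.  The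
-- integrand y ↦ d(y⁻¹ Π_a) c(y) is right K-invariant, so h counts the cosets for which
-- ρ Π_a ∈ K Π_b H.  As ℓ < a - 1, ρ Π_a = (z^t, z^{t+1} p; 0, z^{a+i}) with p ≡ 1 mod z;
-- separating p into its even and odd parts shows that ρ Π_a ∈ K Π_{a+i-t} H.  For σ : z ↦ -z,
-- which fixes H, the matrix g σ(g)⁻¹ is changed only by K when g moves in K g H, and for
-- g = Π_b the least valuation of its entries is 1 - b because 2 ≠ 0; so the double cosets
-- K Π_b H are disjoint and only i - t = j contributes.  The number of v is then 1 for i = 0,
-- q^ℓ for t = 0, and (q - 1) q^{i-1} otherwise.

module Submission where

open import Defs
open import Algebra.Bundles using (AbelianGroup; CommutativeRing; Group; Monoid)
import Algebra.Properties.AbelianGroup as AbelianGroupProperties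
import Algebra.Properties.Group as GroupProperties
import Algebra.Properties.Ring as RingProperties
open import Algebra.Solver.Ring.AlmostCommutativeRing
  using (fromCommutativeRing; _-Raw-AlmostCommutative⟶_)
open import Data.Fin.Base using (Fin; zero; suc; punchIn; punchOut; combine; remQuot)
import Data.Fin.Properties as Fin
open import Data.Integer as ℤ using (ℤ; +_; -[1+_]; _⊖_; 0ℤ; 1ℤ; +≤+)
import Data.Integer.Divisibility as ℤ
import Data.Integer.Divisibility.Signed as Signed
import Data.Integer.Properties as ℤ
import Data.Integer.Tactic.RingSolver as ℤ-Solver
open import Data.List.Base using (List; []; _∷_)
open import Data.List.Relation.Unary.Any using (Any; here; there)
open import Data.Maybe.Base using (map)
open import Data.Nat as ℕ using (ℕ; zero; suc; z≤n; s≤s)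
import Data.Nat.Divisibility as ℕ
import Data.Nat.DivMod as ℕ
import Data.Nat.Properties as ℕ
open import Data.Product using (∃; ∃₂; _×_; _,_; proj₁; proj₂; uncurry)
open import Data.Rational as ℚ using (ℚ; 0ℚ; 1ℚ) renaming (_/_ to _÷_)
import Data.Rational.Properties as ℚ
import Data.Rational.Unnormalised as ℚᵘ
import Data.Rational.Unnormalised.Properties as ℚᵘ
open import Data.Sum using (_⊎_; inj₁; inj₂)
open import Function.Base using (_∘_)
open import Function.Bundles using (Inverse)
open import Level using (Level; _⊔_) renaming (suc to lsuc)
open import Relation.Binary.Definitions using (tri<; tri≈; tri>)
open import Relation.Binary.PropositionalEquality as ≡ using (_≡_)
import Relation.Binary.Reasoning.Setoid as SetoidReasoning
open import Relation.Nullary using (¬_; contradiction; Dec; yes; no)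
import Relation.Nullary.Decidable as Dec

-- That ρ Π_a reaches some Π_b rests on linear algebra: (1, z) is a basis of k((z)) over k((z²)),
-- and so is (1, z p), since the odd part z w of z p is not zero. Hence for every f ≠ 0 some h ∈ H
-- satisfies z^t (1, z p) h = f (1, z). The freedom lies in f: the choices f = w for t even and f =
-- p w for t odd make the second row of u integral and det u a unit in x h = u Π_b. The parity of t
-- matters because the scalar z^t belongs to H only when t is even. Whether a Laurent series
-- vanishes cannot be decided, so valuations appear only through membership in z^m k[[z]], which is
-- decidable because equality in the finite field k is. This also yields an indicator function of K.
-- The integrand is a finite sum of its left translates, each of integral 1 by left invariance and
-- normalisation.

module IntegerCoefficients {c e} (R : CommutativeRing c e) where
  open CommutativeRing R
  open import Algebra.Properties.Semiring.Mult.TCOptimised semiring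
    using (×-homo-+; ×1-homo-*) renaming (_×_ to infixl 8 _⋆_)
  open RingProperties ring
    using (-0#≈0#; -‿involutive; -‿distribˡ-*; -‿distribʳ-*)
  open AbelianGroupProperties +-abelianGroup using (⁻¹-∙-comm)
  open SetoidReasoning setoid

  private
    -- The ring solver compares coefficients by a decision procedure. Equality in R has none, so
    -- integers act through their canonical image.
    ι : ℤ → Carrier
    ι (+ n)    = n ⋆ 1#
    ι -[1+ n ] = - (suc n ⋆ 1#)

    ι-⊖ : ∀ m n → ι (m ⊖ n) ≈ m ⋆ 1# - n ⋆ 1#
    ι-⊖ zero    zero    = sym (-‿inverseʳ 0#)
    ι-⊖ zero    (suc n) = sym (+-identityˡ _)
    ι-⊖ (suc m) zero    = sym (trans (+-congˡ -0#≈0#) (+-identityʳ _))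
    ι-⊖ (suc m) (suc n) = begin
      ι (suc m ⊖ suc n)                     ≡⟨ ≡.cong ι (ℤ.[1+m]⊖[1+n]≡m⊖n m n) ⟩
      ι (m ⊖ n)                             ≈⟨ ι-⊖ m n ⟩
      m ⋆ 1# - n ⋆ 1#                       ≈⟨ +-congʳ
          (trans (+-congʳ (-‿inverseˡ 1#)) (+-identityˡ _)) ⟨
      - 1# + 1# + m ⋆ 1# - n ⋆ 1#           ≈⟨ +-congʳ (trans (+-assoc _ _ _) (+-comm _ _)) ⟩
      1# + m ⋆ 1# + - 1# - n ⋆ 1#           ≈⟨ +-assoc _ _ _ ⟩
      1# + m ⋆ 1# + (- 1# - n ⋆ 1#)         ≈⟨ +-congˡ (⁻¹-∙-comm _ _) ⟩
      1# + m ⋆ 1# - (1# + n ⋆ 1#)           ≈⟨ +-cong (×-homo-+ 1# 1 m) (-‿cong (×-homo-+ 1# 1 n)) ⟨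
      suc m ⋆ 1# - suc n ⋆ 1#               ∎

    ι-+ : ∀ i j → ι (i ℤ.+ j) ≈ ι i + ι j
    ι-+ (+ m)    (+ n)    = ×-homo-+ 1# m n
    ι-+ (+ m)    -[1+ n ] = ι-⊖ m (suc n)
    ι-+ -[1+ m ] (+ n)    = trans (ι-⊖ n (suc m)) (+-comm _ _)
    ι-+ -[1+ m ] -[1+ n ] = begin
      - (suc (suc (m ℕ.+ n)) ⋆ 1#)       ≡⟨ ≡.cong (λ l → - (suc l ⋆ 1#)) (ℕ.+-suc m n) ⟨
      - ((suc m ℕ.+ suc n) ⋆ 1#)         ≈⟨ -‿cong (×-homo-+ 1# (suc m) (suc n)) ⟩
      - (suc m ⋆ 1# + suc n ⋆ 1#)        ≈⟨ ⁻¹-∙-comm _ _ ⟨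
      - (suc m ⋆ 1#) + - (suc n ⋆ 1#)    ∎

    ι-neg : ∀ i → ι (ℤ.- i) ≈ - ι i
    ι-neg (+ zero)  = sym -0#≈0#
    ι-neg (+ suc n) = refl
    ι-neg -[1+ n ]  = sym (-‿involutive _)

    ι-*⁺ : ∀ m j → ι (+ m ℤ.* j) ≈ ι (+ m) * ι j
    ι-*⁺ m (+ n)    = trans (reflexive (≡.cong ι (≡.sym (ℤ.pos-* m n)))) (×1-homo-* m n)
    ι-*⁺ m -[1+ n ] = begin
      ι (+ m ℤ.* -[1+ n ])        ≡⟨ ≡.cong ι (ℤ.neg-distribʳ-* (+ m) (+ suc n)) ⟨
      ι (ℤ.- (+ m ℤ.* + suc n))   ≈⟨ ι-neg (+ m ℤ.* + suc n) ⟩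
      - ι (+ m ℤ.* + suc n)       ≈⟨ -‿cong (ι-*⁺ m (+ suc n)) ⟩
      - (m ⋆ 1# * (suc n ⋆ 1#))   ≈⟨ -‿distribʳ-* _ _ ⟩
      m ⋆ 1# * - (suc n ⋆ 1#)     ∎

    ι-* : ∀ i j → ι (i ℤ.* j) ≈ ι i * ι j
    ι-* (+ m)    j = ι-*⁺ m j
    ι-* -[1+ m ] j = begin
      ι (-[1+ m ] ℤ.* j)        ≡⟨ ≡.cong ι (ℤ.neg-distribˡ-* (+ suc m) j) ⟨
      ι (ℤ.- (+ suc m ℤ.* j))   ≈⟨ ι-neg (+ suc m ℤ.* j) ⟩
      - ι (+ suc m ℤ.* j)       ≈⟨ -‿cong (ι-*⁺ (suc m) j) ⟩
      - (suc m ⋆ 1# * ι j)      ≈⟨ -‿distribˡ-* _ _ ⟩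
      - (suc m ⋆ 1#) * ι j      ∎

    morphism : ℤ.+-*-rawRing -Raw-AlmostCommutative⟶ fromCommutativeRing R
    morphism = record
      { ⟦_⟧ = ι ; +-homo = ι-+ ; *-homo = ι-* ; -‿homo = ι-neg ; 0-homo = refl ; 1-homo = refl }

  open import Algebra.Solver.Ring ℤ.+-*-rawRing (fromCommutativeRing R) morphism
    (λ i j → map (λ i≡j → reflexive (≡.cong ι i≡j)) (Dec.dec⇒maybe (i ℤ.≟ j))) public
    using (solve; _:=_; _:+_; _:*_; _:-_; :-_; con)

-- Determinants and invertible 2 × 2 matrices

module Determinants {r₁ r₂} (R : CommutativeRing r₁ r₂) where
  open CommutativeRing R
  open IntegerCoefficients R
  open Matrices R

  -- The solver knows identities of polynomials only. A hypothesis a ≈ b enters as a multiple of a -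
  -- b with an explicit cofactor c; nested calls certify membership in an ideal with several
  -- generators.
  modulo : ∀ {x y a b} c → a ≈ b → x ≈ y + c * (a - b) → x ≈ y
  modulo {y = y} {b = b} c p q = trans q (trans
    (+-congˡ (*-congˡ (+-congʳ p)))
    (solve 3 (λ y c b → y :+ c :* (b :- b) := y) refl y c b))

  infix 4 _≋_
  _≋_ : Mat₂ → Mat₂ → Set r₂
  _≋_ = Monoid._≈_ monoid

  det : Mat₂ → Carrier
  det A = e₁₁ A * e₂₂ A - e₁₂ A * e₂₁ A

  det-· : ∀ A B → det (A · B) ≈ det A * det B
  det-· (mat a b c d) (mat a′ b′ c′ d′) =
    solve 8 (λ a b c d a′ b′ c′ d′ →
      (a :* a′ :+ b :* c′) :* (c :* b′ :+ d :* d′) :- (a :* b′ :+ b :* d′) :* (c :* a′ :+ d :* c′)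
        := (a :* d :- b :* c) :* (a′ :* d′ :- b′ :* c′)) refl a b c d a′ b′ c′ d′

  fromDet : ∀ A d → det A * d ≈ 1# → Unit
  fromDet A@(mat a b c d) δ p = record
    { val = A
    ; inv = mat (δ * d) (- (δ * b)) (- (δ * c)) (δ * a)
    ; rightInverse = entrywise
        (trans (solve 5 (λ a b c d δ → a :* (δ :* d) :+ b :* (:- (δ :* c)) :=
            (a :* d :- b :* c) :* δ) refl a b c d δ) p)
        (solve 3 (λ a b δ → a :* (:- (δ :* b)) :+ b :* (δ :* a) := con (+ 0)) refl a b δ)
        (solve 3 (λ c d δ → c :* (δ :* d) :+ d :* (:- (δ :* c)) := con (+ 0)) refl c d δ)
        (trans (solve 5 (λ a b c d δ → c :* (:- (δ :* b)) :+ d :* (δ :* a) :=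
            (a :* d :- b :* c) :* δ) refl a b c d δ) p)
    ; leftInverse = entrywise
        (trans (solve 5 (λ a b c d δ → δ :* d :* a :+ :- (δ :* b) :* c := (a :* d :- b :* c) :* δ)
            refl a b c d δ) p)
        (solve 3 (λ b d δ → δ :* d :* b :+ :- (δ :* b) :* d := con (+ 0)) refl b d δ)
        (solve 3 (λ a c δ → :- (δ :* c) :* a :+ δ :* a :* c := con (+ 0)) refl a c δ)
        (trans (solve 5 (λ a b c d δ → :- (δ :* c) :* b :+ δ :* a :* d := (a :* d :- b :* c) :* δ)
            refl a b c d δ) p)
    }

  module Subring {p} (P : Carrier → Set p)
    (P-resp : ∀ {x y} → x ≈ y → P x → P y)
    (P-+ : ∀ {x y} → P x → P y → P (x + y))
    (P-* : ∀ {x y} → P x → P y → P (x * y))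
    (P-neg : ∀ {x} → P x → P (- x)) where

    fromDet∈GL₂ : ∀ {a b c d δ} (q : det (mat a b c d) * δ ≈ 1#) →
      P a → P b → P c → P d → P δ → GL₂[ P ] (fromDet (mat a b c d) δ q)
    fromDet∈GL₂ q pa pb pc pd pδ =
      entrywise pa pb pc pd ,
      entrywise (P-* pδ pd) (P-neg (P-* pδ pb)) (P-neg (P-* pδ pc)) (P-* pδ pa)

    -- B A = 1 gives adj B = det B · A, hence B = det B · adj A.
    det∈⇒GL₂ : ∀ g → Entrywise (λ x _ → P x) (val g) (val g) → P (det (inv g)) → GL₂[ P ] g
    det∈⇒GL₂ g A∈ δ∈ = A∈ , entrywise
      (P-resp b₁₁ (P-* δ∈ (p₂₂ A∈))) (P-resp b₁₂ (P-neg (P-* δ∈ (p₁₂ A∈))))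
      (P-resp b₂₁ (P-neg (P-* δ∈ (p₂₁ A∈)))) (P-resp b₂₂ (P-* δ∈ (p₁₁ A∈)))
      where
      A = val g
      B = inv g
      BA = leftInverse g
      open Mat₂ A renaming (e₁₁ to a; e₁₂ to b; e₂₁ to c; e₂₂ to d)
      open Mat₂ B renaming (e₁₁ to w; e₁₂ to x; e₂₁ to y; e₂₂ to z)
      adj·BA : ∀ {m m′ n n′ v} r s → m ≈ m′ → n ≈ n′ → r * m + s * n ≈ v → v ≈ r * m′ + s * n′
      adj·BA r s p q h = trans (sym h) (+-cong (*-congˡ p) (*-congˡ q))
      b₁₁ : det B * d ≈ w
      b₁₁ = trans (adj·BA (- y) w (p₁₂ BA) (p₂₂ BA) (solve 6 (λ w x y z b d →
          :- y :* (w :* b :+ x :* d) :+ w :* (y :* b :+ z :* d) := (w :* z :- x :* y) :* d)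
              refl w x y z b d))
        (solve 2 (λ w y → :- y :* con (+ 0) :+ w :* con (+ 1) := w) refl w y)
      b₁₂ : - (det B * b) ≈ x
      b₁₂ = trans (adj·BA (- z) x (p₁₂ BA) (p₂₂ BA) (solve 6 (λ w x y z b d →
          :- z :* (w :* b :+ x :* d) :+ x :* (y :* b :+ z :* d) := :- ((w :* z :- x :* y) :* b))
              refl w x y z b d))
        (solve 2 (λ x z → :- z :* con (+ 0) :+ x :* con (+ 1) := x) refl x z)
      b₂₁ : - (det B * c) ≈ y
      b₂₁ = trans (adj·BA y (- w) (p₁₁ BA) (p₂₁ BA) (solve 6 (λ w x y z a c →
          y :* (w :* a :+ x :* c) :+ :- w :* (y :* a :+ z :* c) := :- ((w :* z :- x :* y) :* c))
              refl w x y z a c))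
        (solve 2 (λ y w → y :* con (+ 1) :+ :- w :* con (+ 0) := y) refl y w)
      b₂₂ : det B * a ≈ z
      b₂₂ = trans (adj·BA z (- x) (p₁₁ BA) (p₂₁ BA) (solve 6 (λ w x y z a c →
          z :* (w :* a :+ x :* c) :+ :- x :* (y :* a :+ z :* c) := (w :* z :- x :* y) :* a)
              refl w x y z a c))
        (solve 2 (λ z x → z :* con (+ 1) :+ :- x :* con (+ 0) := z) refl z x)

-- Abstract properties of k((z)): valuations, k((z²)) and the involution σ

-- What the argument uses of k((z)): O m is z^m k[[z]], S is k((z²)) and σ is z ↦ -z.
record LaurentField {r₁ r₂} (R : CommutativeRing r₁ r₂) : Set (r₁ ⊔ lsuc r₂) where
  open CommutativeRing R
  field
    O          : ℤ → Carrier → Set r₂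
    O-resp     : ∀ {m x y} → x ≈ y → O m x → O m y
    O-0        : ∀ {m} → O m 0#
    O-+        : ∀ {m x y} → O m x → O m y → O m (x + y)
    O-neg      : ∀ {m x} → O m x → O m (- x)
    O-*        : ∀ {m n x y} → O m x → O n y → O (m ℤ.+ n) (x * y)
    O-antitone : ∀ {m n x} → m ℤ.≤ n → O n x → O m x
    zp         : ℤ → Carrier
    zp-+       : ∀ m n → zp m * zp n ≈ zp (m ℤ.+ n)
    zp-0       : zp 0ℤ ≈ 1#
    zp-inverse : ∀ m → zp m * zp (ℤ.- m) ≈ 1#
    O-zp       : ∀ m → O m (zp m)
    unit       : ∀ {x} → O 0ℤ x → ¬ O 1ℤ x → ∃ λ y → O 0ℤ y × x * y ≈ 1#
    -- The bound n is what makes this decidable: finitely many coefficients cannot show that a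
    -- series is zero.
    order      : ∀ {x} → O 0ℤ x → ∀ n →
                 O (+ n) x ⊎ ∃ λ t → t ℕ.< n × O (+ t) x × ¬ O (+ suc t) x
    -- Here 2 ≠ 0 enters: in characteristic 2 the element vanishes and lies in every `O m`.
    O-2z^      : ∀ {m n} → O m (zp n + zp n) → m ℤ.≤ n
    S          : Carrier → Set r₂
    S-zp       : ∀ m → S (zp (m ℤ.+ m))
    σ          : Carrier → Carrier
    σ-cong     : ∀ {x y} → x ≈ y → σ x ≈ σ y
    σ-+        : ∀ x y → σ (x + y) ≈ σ x + σ y
    σ-*        : ∀ x y → σ (x * y) ≈ σ x * σ y
    σ-neg      : ∀ x → σ (- x) ≈ - σ x
    σ-σ        : ∀ x → σ (σ x) ≈ x
    σ-z        : σ (zp 1ℤ) ≈ - zp 1ℤ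
    σ-O        : ∀ {m x} → O m x → O m (σ x)
    S⇒fixed    : ∀ {x} → S x → σ x ≈ x
    fixed⇒S    : ∀ {x} → σ x ≈ x → S x
    ½          : Carrier
    ½+½        : ½ + ½ ≈ 1#
    O-½        : O 0ℤ ½
    σ-½        : σ ½ ≈ ½

module LaurentFieldProperties {r₁ r₂} {R : CommutativeRing r₁ r₂} (F : LaurentField R) where
  open CommutativeRing R
  open LaurentField F
  open IntegerCoefficients R
  open Determinants R using (modulo)

  z : Carrier
  z = zp 1ℤ

  O-*≡ : ∀ {m n l x y} → m ℤ.+ n ≡ l → O m x → O n y → O l (x * y)
  O-*≡ ≡.refl = O-*

  O-zp₀ : ∀ n → O 0ℤ (zp (+ n))
  O-zp₀ n = O-antitone (+≤+ z≤n) (O-zp (+ n))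

  O-1 : O 0ℤ 1#
  O-1 = O-resp zp-0 (O-zp 0ℤ)

  -- If 1 were in `O 1ℤ`, so would be 1 + 1 = 2 z^0, whose valuation `O-2z^` bounds by 0.
  1∉O₁ : ¬ O 1ℤ 1#
  1∉O₁ p with O-2z^ {1ℤ} {0ℤ} (O-resp (+-cong (sym zp-0) (sym zp-0)) (O-+ p p))
  ... | +≤+ ()

  unit⇒∉O₁ : ∀ {x y} → O 0ℤ y → x * y ≈ 1# → ¬ O 1ℤ x
  unit⇒∉O₁ y∈ p x∈ = 1∉O₁ (O-resp p (O-* x∈ y∈))

  unit-1+O₁ : ∀ {x} → O 1ℤ (x - 1#) → ∃ λ y → O 0ℤ y × x * y ≈ 1#
  unit-1+O₁ {x} p = unit
    (O-resp (solve 1 (λ x → x :- con (+ 1) :+ con (+ 1) := x) refl x)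
      (O-+ (O-antitone (+≤+ z≤n) p) O-1))
    λ x∈ → 1∉O₁ (O-resp (solve 1 (λ x → x :- (x :- con (+ 1)) := con (+ 1)) refl x)
        (O-+ x∈ (O-neg p)))

  S-resp : ∀ {x y} → x ≈ y → S x → S y
  S-resp p s = fixed⇒S (trans (σ-cong (sym p)) (trans (S⇒fixed s) p))

  S-+ : ∀ {x y} → S x → S y → S (x + y)
  S-+ s t = fixed⇒S (trans (σ-+ _ _) (+-cong (S⇒fixed s) (S⇒fixed t)))

  S-* : ∀ {x y} → S x → S y → S (x * y)
  S-* s t = fixed⇒S (trans (σ-* _ _) (*-cong (S⇒fixed s) (S⇒fixed t)))

  S-neg : ∀ {x} → S x → S (- x)
  S-neg s = fixed⇒S (trans (σ-neg _) (-‿cong (S⇒fixed s)))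

  S-zp≡ : ∀ {n} m → m ℤ.+ m ≡ n → S (zp n)
  S-zp≡ m ≡.refl = S-zp m

  S-1 : S 1#
  S-1 = S-resp zp-0 (S-zp 0ℤ)

  S-0 : S 0#
  S-0 = S-resp (-‿inverseʳ 1#) (S-+ S-1 (S-neg S-1))

  σ-1 : σ 1# ≈ 1#
  σ-1 = S⇒fixed S-1

  -- As σ x = x, the element σ y is an inverse of x too, and inverses are unique.
  S-inverse : ∀ {x y} → x * y ≈ 1# → S x → S y
  S-inverse {x} {y} p s = fixed⇒S (trans
    (modulo (- σ y) p (solve 3 (λ x y y′ → y′ := y′ :* (x :* y) :+ :- y′ :* (x :* y :- con (+ 1)))
        refl x y (σ y)))
    (trans (solve 3 (λ x y y′ → y′ :* (x :* y) := x :* y′ :* y) refl x y (σ y))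
    (trans (*-congʳ (trans (*-congʳ (sym (S⇒fixed s)))
        (trans (sym (σ-* x y)) (trans (σ-cong p) σ-1))))
      (*-identityˡ y))))

  *-one : ∀ {x y} → x ≈ 1# → y ≈ 1# → x * y ≈ 1#
  *-one p q = trans (*-cong p q) (*-identityˡ 1#)

  zp-*≡ : ∀ {m n l} → m ℤ.+ n ≡ l → zp m * zp n ≈ zp l
  zp-*≡ {m} {n} ≡.refl = zp-+ m n

  -- Here p′ = σ p, so that w and g are the even and the odd part of p.
  record EvenOdd (p : Carrier) : Set (r₁ ⊔ r₂) where
    field
      p′ w g    : Carrier
      p≈w+g     : p ≈ w + g
      p′≈w-g    : p′ ≈ w - g
      O-p       : O 0ℤ p
      O-p′      : O 0ℤ p′
      O-w       : O 0ℤ w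
      S-w       : S w
      S-zg      : S (z * g)
      -- The norm of p from k((z)) to k((z²)).
      S-norm    : S (p * p′)
      w⁻¹ n⁻¹   : Carrier
      w⁻¹-inv   : w * w⁻¹ ≈ 1#
      n⁻¹-inv   : p * p′ * n⁻¹ ≈ 1#
      O-w⁻¹     : O 0ℤ w⁻¹
      O-n⁻¹     : O 0ℤ n⁻¹

  evenOdd : ∀ {p} → O 1ℤ (p - 1#) → EvenOdd p
  evenOdd {p} p-1∈ = record
    { p′ = p′ ; w = w ; g = g
    ; p≈w+g = modulo (- p) ½+½ (solve 3 (λ p p′ h →
        p := h :* (p :+ p′) :+ h :* (p :- p′) :+ :- p :* (h :+ h :- con (+ 1))) refl p p′ ½)
    ; p′≈w-g = modulo (- p′) ½+½ (solve 3 (λ p p′ h →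
        p′ := h :* (p :+ p′) :- h :* (p :- p′) :+ :- p′ :* (h :+ h :- con (+ 1))) refl p p′ ½)
    ; O-p = O-p
    ; O-p′ = σ-O O-p
    ; O-w = O-* O-½ (O-+ O-p (σ-O O-p))
    ; S-w = S-w
    ; S-zg = fixed⇒S (trans (σ-* _ _)
        (trans (*-cong σ-z (trans (σ-* _ _) (*-cong σ-½ (trans (σ-+ _ _) (+-congˡ (σ-neg _))))))
        (trans (*-congˡ (*-congˡ (+-congˡ (-‿cong (σ-σ p)))))
        (solve 4 (λ z h p p′ → :- z :* (h :* (p′ :- p)) := z :* (h :* (p :- p′))) refl z ½ p p′))))
    ; S-norm = fixed⇒S (trans (σ-* _ _) (trans (*-congˡ (σ-σ p)) (*-comm _ _)))
    ; w⁻¹ = proj₁ w-unit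
    ; n⁻¹ = q * σ q
    ; w⁻¹-inv = proj₂ (proj₂ w-unit)
    ; n⁻¹-inv = trans (solve 4 (λ p p′ q q′ → p :* p′ :* (q :* q′) := p :* q :* (p′ :* q′))
        refl p p′ q (σ q))
        (*-one pq≈1 (trans (sym (σ-* p q)) (trans (σ-cong pq≈1) σ-1)))
    ; O-w⁻¹ = proj₁ (proj₂ w-unit)
    ; O-n⁻¹ = O-* q∈ (σ-O q∈)
    }
    where
    p′ = σ p
    w = ½ * (p + p′)
    g = ½ * (p - p′)
    O-p : O 0ℤ p
    O-p = O-resp (solve 1 (λ x → x :- con (+ 1) :+ con (+ 1) := x) refl p)
      (O-+ (O-antitone (+≤+ z≤n) p-1∈) O-1)
    p-unit = unit-1+O₁ p-1∈
    q = proj₁ p-unit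
    q∈ = proj₁ (proj₂ p-unit)
    pq≈1 = proj₂ (proj₂ p-unit)
    S-w : S w
    S-w = fixed⇒S (trans (σ-* _ _)
        (*-cong σ-½ (trans (σ-+ _ _) (trans (+-congˡ (σ-σ p)) (+-comm _ _)))))
    p′-1∈ : O 1ℤ (p′ - 1#)
    p′-1∈ = O-resp (trans (σ-+ _ _) (+-congˡ (trans (σ-neg _) (-‿cong σ-1)))) (σ-O p-1∈)
    -- w - 1 is the mean of p - 1 and σ(p) - 1, both divisible by z.
    w-unit = unit-1+O₁ {w} (O-resp
      (modulo (- 1#) ½+½ (solve 3 (λ p p′ h → h :* (p :- con (+ 1) :+ (p′ :- con (+ 1)))
        := h :* (p :+ p′) :- con (+ 1) :+ :- con (+ 1) :* (h :+ h :- con (+ 1))) refl p p′ ½))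
      (O-* O-½ (O-+ p-1∈ p′-1∈)))

-- Explicit factorisations in K Π_b H

module GL₂Properties {r₁ r₂} {R : CommutativeRing r₁ r₂} (F : LaurentField R) where
  open CommutativeRing R
  open LaurentField F
  open LaurentFieldProperties F
  open IntegerCoefficients R
  open Determinants R
  open Matrices R
  private module M = Monoid monoid
  private module G = Group group
  open G using (_∙_; _⁻¹)

  K H : Unit → Set r₂
  K = GL₂[ O 0ℤ ]
  H = GL₂[ S ]

  module 𝒪 = Subring (O 0ℤ) O-resp O-+ O-* O-neg
  module 𝒮 = Subring S S-resp S-+ S-* S-neg

  triangular : ℤ → Carrier → ℤ → Unit
  triangular m v n = upper {zp m} {zp (ℤ.- m)} {zp n} {zp (ℤ.- n)} (zp-inverse m) v (zp-inverse n)

  diag : ℤ → ℤ → Unit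
  diag m n = triangular m 0# n

  Π : ℤ → Unit
  Π b = triangular 0ℤ (zp 1ℤ) b

  _⟨_⟩_ : (Unit → Set r₂) → Unit → (Unit → Set r₂) → Unit → Set (r₁ ⊔ r₂)
  (A ⟨ x ⟩ B) g = ∃ λ u → ∃ λ v → A u × B v × g G.≈ u ∙ x ∙ v

  -- Membership is tested in the form A h = u Π_b, so that no inverse has to be multiplied out.
  ⟨⟩-intro : ∀ x u h {A b} → val x ≋ A → K u → H h → A · val h ≋ val u · val (Π b) → (K ⟨ Π b ⟩ H) x
  ⟨⟩-intro x u h {A} {b} p u∈ h∈ q = u , h ⁻¹ , u∈ , (proj₂ h∈ , proj₁ h∈) , eq
    where
    open GroupProperties group using (x≈z//y)
    eq : x G.≈ u ∙ Π b ∙ h ⁻¹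
    eq = x≈z//y x h (u ∙ Π b) (M.trans (M.∙-congʳ p) q)

  halve : ∀ t → ∃ λ s → t ≡ s ℕ.+ s ⊎ t ≡ suc (s ℕ.+ s)
  halve zero = 0 , inj₁ ≡.refl
  halve (suc t) with halve t
  ... | s , inj₁ ≡.refl = s , inj₂ ≡.refl
  ... | s , inj₂ ≡.refl = suc s , inj₁ (≡.cong suc (≡.sym (ℕ.+-suc s s)))

  module _ {p b} (1≤b : 1ℤ ℤ.≤ b) (p-1∈ : O 1ℤ (p - 1#)) where
    open EvenOdd (evenOdd p-1∈)
    private
      zb = zp b
      Z₀ = zp 0ℤ

    -- In both cases h ∈ H is chosen so that the row (1 , z p) h is proportional to (1 , z):
    -- z^{-t} (w, -zg; 0, 1) for t even, and z^{-t-1} (0, z² p σ(p); w, zg) for t odd.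
    KΠH-even : ∀ s x → let T = + (s ℕ.+ s) in
      val x ≋ mat (zp T) (zp T * (z * p)) 0# (zp (T ℤ.+ b)) → (K ⟨ Π b ⟩ H) x
    KΠH-even s x eq = ⟨⟩-intro x (fromDet _ w⁻¹ u-det) (fromDet _ (zp T * zp T * w⁻¹) h-det) eq
      (𝒪.fromDet∈GL₂ u-det O-w O-0 O-0 O-1 O-w⁻¹)
      (𝒮.fromDet∈GL₂ h-det
        (S-* S-zT⁻¹ S-w) (S-neg (S-* S-zT⁻¹ S-zg)) S-0 S-zT⁻¹
        (S-* (S-* S-zT S-zT) (S-inverse w⁻¹-inv S-w)))
      (entrywise
        (trans (modulo w (zp-inverse T) (solve 5 (λ y y′ w z p →
            y :* (y′ :* w) :+ y :* (z :* p) :* con (+ 0)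
              := w :* con (+ 1) :+ con (+ 0) :* con (+ 0) :+ w :* (y :* y′ :- con (+ 1)))
                  refl (zp T) zT⁻¹ w z p))
          (+-congʳ (*-congˡ (sym zp-0))))
        (modulo (z * (p - g)) (zp-inverse T) (modulo z p≈w+g
          (solve 7 (λ y y′ w z p g zb →
            y :* (:- (y′ :* (z :* g))) :+ y :* (z :* p) :* y′
              := w :* z :+ con (+ 0) :* zb :+ z :* (p :- g) :* (y :* y′ :- con (+ 1))
                 :+ z :* (p :- (w :+ g)))
            refl (zp T) zT⁻¹ w z p g zb)))
        (solve 3 (λ u v w → con (+ 0) :* u :+ v :* con (+ 0) :=
            con (+ 0) :* w :+ con (+ 1) :* con (+ 0))
          refl (zT⁻¹ * w) (zp (T ℤ.+ b)) Z₀)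
        (trans (solve 4 (λ u v w z → con (+ 0) :* u :+ v :* w :=
            con (+ 0) :* z :+ con (+ 1) :* (v :* w))
            refl (- (zT⁻¹ * (z * g))) (zp (T ℤ.+ b)) zT⁻¹ z)
          (+-congˡ (*-congˡ (zp-*≡ (ex₁ T b))))))
      where
      T = + (s ℕ.+ s)
      zT⁻¹ = zp (ℤ.- T)
      u-det : det (mat w 0# 0# 1#) * w⁻¹ ≈ 1#
      u-det = trans (solve 2
          (λ w w′ → (w :* con (+ 1) :- con (+ 0) :* con (+ 0)) :* w′ := w :* w′) refl w w⁻¹) w⁻¹-inv
      h-det : det (mat (zT⁻¹ * w) (- (zT⁻¹ * (z * g))) 0# zT⁻¹) * (zp T * zp T * w⁻¹) ≈ 1#
      h-det = trans (solve 6
          (λ y y′ w w′ z g → (y′ :* w :* y′ :- (:- (y′ :* (z :* g))) :* con (+ 0)) :* (y :* y :* w′)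
            := y :* y′ :* (y :* y′) :* (w :* w′)) refl (zp T) zT⁻¹ w w⁻¹ z g)
          (*-one (*-one (zp-inverse T) (zp-inverse T)) w⁻¹-inv)
      ex₁ : ∀ t b → t ℤ.+ b ℤ.+ ℤ.- t ≡ b
      ex₁ = ℤ-Solver.solve-∀
      S-zT : S (zp T)
      S-zT = S-zp≡ (+ s) ≡.refl
      S-zT⁻¹ : S zT⁻¹
      S-zT⁻¹ = S-zp≡ (ℤ.- + s) (≡.sym (ℤ.neg-distrib-+ (+ s) (+ s)))

    -- The even power z^(t+1) now stands in the second column, which h therefore moves to the front.
    -- The first row becomes p w (1, z) because σ(p) + g = w.
    KΠH-odd : ∀ s x → let T = + suc (s ℕ.+ s) in
      val x ≋ mat (zp T) (zp T * (z * p)) 0# (zp (T ℤ.+ b)) → (K ⟨ Π b ⟩ H) x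
    KΠH-odd s x eq = ⟨⟩-intro x (fromDet _ (- (w⁻¹ * n⁻¹)) u-det)
        (fromDet _ (- (zp (ℤ.- (ℤ.- (T ℤ.+ 1ℤ))) * zp (ℤ.- (1ℤ ℤ.- T)) * (w⁻¹ * n⁻¹))) h-det) eq
      (𝒪.fromDet∈GL₂ u-det
        (O-* O-p O-w) O-0 (O-* (O-antitone (ℤ.i≤j⇒0≤j-i 1≤b) (O-zp (b ℤ.- 1ℤ))) O-w) (O-neg O-p′)
        (O-neg (O-* O-w⁻¹ O-n⁻¹)))
      (𝒮.fromDet∈GL₂ h-det
        S-0 (S-* S-s₂ S-norm) (S-* S-s₁ S-w) (S-* S-s₁ S-zg)
        (S-neg (S-* (S-* (S-inverse (zp-inverse _) S-s₁) (S-inverse (zp-inverse _) S-s₂))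
          (S-* (S-inverse w⁻¹-inv S-w) (S-inverse n⁻¹-inv S-norm)))))
      (entrywise
        (trans (modulo (p * w) Tzs₁ (solve 5 (λ y s₁ w z p →
            y :* con (+ 0) :+ y :* (z :* p) :* (s₁ :* w)
              := p :* w :* con (+ 1) :+ con (+ 0) :* con (+ 0)
                  :+ p :* w :* (y :* z :* s₁ :- con (+ 1)))
            refl (zp T) s₁ w z p))
          (+-congʳ (*-congˡ (sym zp-0))))
        (modulo (p * (z * g)) Tzs₁ (modulo (p * p′) Ts₂ (modulo (p * z) p′≈w-g
          (solve 9 (λ y s₁ s₂ w z p p′ g zb →
            y :* (s₂ :* (p :* p′)) :+ y :* (z :* p) :* (s₁ :* (z :* g))
              := p :* w :* z :+ con (+ 0) :* zb :+ p :* (z :* g) :* (y :* z :* s₁ :- con (+ 1))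
                 :+ p :* p′ :* (y :* s₂ :- z) :+ p :* z :* (p′ :- (w :- g)))
            refl (zp T) s₁ s₂ w z p p′ g zb))))
        (trans (modulo w Tbs₁ (solve 5 (λ y s₁ w u p′ →
            con (+ 0) :* con (+ 0) :+ y :* (s₁ :* w)
              := u :* w :* con (+ 1) :+ (:- p′) :* con (+ 0) :+ w :* (y :* s₁ :- u))
            refl (zp (T ℤ.+ b)) s₁ w (zp (b ℤ.- 1ℤ)) p′))
          (+-congʳ (*-congˡ (sym zp-0))))
        (modulo (z * g) Tbs₁ (modulo zb p′≈w-g (modulo (g - w) b-1
          (solve 9 (λ y s₁ w u p′ z g zb v →
            con (+ 0) :* v :+ y :* (s₁ :* (z :* g))
              := u :* w :* z :+ (:- p′) :* zb :+ z :* g :* (y :* s₁ :- u) :+ zb :* (p′ :- (w :- g))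
                 :+ (g :- w) :* (u :* z :- zb))
            refl (zp (T ℤ.+ b)) s₁ w (zp (b ℤ.- 1ℤ)) p′ z g zb (s₂ * (p * p′)))))))
      where
      T = + suc (s ℕ.+ s)
      s₁ = zp (ℤ.- (T ℤ.+ 1ℤ))
      s₂ = zp (1ℤ ℤ.- T)
      -- The second row of u solves (u₂₁, u₂₁ z + u₂₂ z^b) = (0, z^(t+b)) h = (z^(b-1) w, z^b g),
      -- whence u₂₂ = g - w = -σ(p). Integrality of u₂₁ is where 1 ≤ b is needed.
      u-det : det (mat (p * w) 0# (zp (b ℤ.- 1ℤ) * w) (- p′)) * - (w⁻¹ * n⁻¹) ≈ 1#
      u-det = trans (solve 6
          (λ p p′ w w′ n′ y → (p :* w :* (:- p′) :- con (+ 0) :* y) :* (:- (w′ :* n′))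
            := w :* w′ :* (p :* p′ :* n′)) refl p p′ w w⁻¹ n⁻¹ (zp (b ℤ.- 1ℤ) * w))
          (*-one w⁻¹-inv n⁻¹-inv)
      h-det : det (mat 0# (s₂ * (p * p′)) (s₁ * w) (s₁ * (z * g)))
        * - (zp (ℤ.- (ℤ.- (T ℤ.+ 1ℤ))) * zp (ℤ.- (1ℤ ℤ.- T)) * (w⁻¹ * n⁻¹)) ≈ 1#
      h-det = trans (solve 9 (λ n w w′ n′ y₁ y₂ y₁′ y₂′ v →
            (con (+ 0) :* v :- y₂ :* n :* (y₁ :* w)) :* (:- (y₁′ :* y₂′ :* (w′ :* n′)))
              := (y₁ :* y₁′) :* (y₂ :* y₂′) :* ((w :* w′) :* (n :* n′)))
            refl (p * p′) w w⁻¹ n⁻¹ s₁ s₂ (zp (ℤ.- (ℤ.- (T ℤ.+ 1ℤ)))) (zp (ℤ.- (1ℤ ℤ.- T)))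
                (s₁ * (z * g)))
          (*-one (*-one (zp-inverse (ℤ.- (T ℤ.+ 1ℤ))) (zp-inverse (1ℤ ℤ.- T)))
              (*-one w⁻¹-inv n⁻¹-inv))
      ex₁ : ∀ t → t ℤ.+ + 1 ℤ.+ ℤ.- (t ℤ.+ + 1) ≡ + 0
      ex₁ = ℤ-Solver.solve-∀
      ex₂ : ∀ t → t ℤ.+ (+ 1 ℤ.- t) ≡ + 1
      ex₂ = ℤ-Solver.solve-∀
      ex₃ : ∀ t b → t ℤ.+ b ℤ.+ ℤ.- (t ℤ.+ + 1) ≡ b ℤ.- + 1
      ex₃ = ℤ-Solver.solve-∀
      ex₄ : ∀ b → b ℤ.- + 1 ℤ.+ + 1 ≡ b
      ex₄ = ℤ-Solver.solve-∀
      ex₅ : ∀ s → ℤ.- (+ 1 ℤ.+ s) ℤ.+ ℤ.- (+ 1 ℤ.+ s) ≡ ℤ.- (+ 1 ℤ.+ (s ℤ.+ s) ℤ.+ + 1)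
      ex₅ = ℤ-Solver.solve-∀
      ex₆ : ∀ s → ℤ.- s ℤ.+ ℤ.- s ≡ + 1 ℤ.- (+ 1 ℤ.+ (s ℤ.+ s))
      ex₆ = ℤ-Solver.solve-∀
      Tzs₁ : zp T * z * s₁ ≈ 1#
      Tzs₁ = trans (*-congʳ (zp-+ T 1ℤ)) (trans (zp-*≡ (ex₁ T)) zp-0)
      Ts₂ : zp T * s₂ ≈ z
      Ts₂ = zp-*≡ (ex₂ T)
      Tbs₁ : zp (T ℤ.+ b) * s₁ ≈ zp (b ℤ.- 1ℤ)
      Tbs₁ = zp-*≡ (ex₃ T b)
      b-1 : zp (b ℤ.- 1ℤ) * z ≈ zb
      b-1 = zp-*≡ (ex₄ b)
      S-s₁ : S s₁
      S-s₁ = S-zp≡ (ℤ.- (+ 1 ℤ.+ + s)) (ex₅ (+ s))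
      S-s₂ : S s₂
      S-s₂ = S-zp≡ (ℤ.- + s) (ex₆ (+ s))

    KΠH-triangular : ∀ t x →
      val x ≋ mat (zp (+ t)) (zp (+ t) * (z * p)) 0# (zp (+ t ℤ.+ b)) → (K ⟨ Π b ⟩ H) x
    KΠH-triangular t x eq with halve t
    ... | s , inj₁ ≡.refl = KΠH-even s x eq
    ... | s , inj₂ ≡.refl = KΠH-odd s x eq

-- Cancellation in groups

module GroupIdentities {g₁ g₂} (𝓖 : Group g₁ g₂) where
  open Group 𝓖
  open GroupProperties 𝓖

  through : ∀ r s y → (r ∙ s ⁻¹) ∙ (s ∙ y) ≈ r ∙ y
  through r s y = trans (sym (assoc _ _ _)) (∙-congʳ (//-rightDividesˡ s r))

  //-common : ∀ r s y → (r ∙ y) ∙ (s ∙ y) ⁻¹ ≈ r ∙ s ⁻¹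
  //-common r s y = sym (x≈z//y (r ∙ s ⁻¹) (s ∙ y) (r ∙ y) (through r s y))

  \\-common : ∀ r y p → (r ∙ y) ⁻¹ ∙ (r ∙ p) ≈ y ⁻¹ ∙ p
  \\-common r y p = sym (y≈x\\z (r ∙ y) (y ⁻¹ ∙ p) (r ∙ p)
    (trans (assoc _ _ _) (∙-congˡ (\\-leftDividesˡ y p))))

  factor : ∀ r a y → y ≈ a ∙ ((r ∙ a) ⁻¹ ∙ (r ∙ y))
  factor r a y = sym (trans (∙-congˡ (\\-common r a y)) (\\-leftDividesˡ a y))

  move : ∀ x u g h → x ≈ u ∙ g ∙ h → g ≈ u ⁻¹ ∙ x ∙ h ⁻¹
  move x u g h p = x≈z//y g h (u ⁻¹ ∙ x) (y≈x\\z u (g ∙ h) x (trans (sym (assoc _ _ _)) (sym p)))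

-- Disjointness of the double cosets K Π_b H

module Disjointness {r₁ r₂} {R : CommutativeRing r₁ r₂} (F : LaurentField R) where
  open CommutativeRing R
  open LaurentField F
  open LaurentFieldProperties F
  open IntegerCoefficients R
  open Determinants R
  open GL₂Properties F
  open Matrices R
  private module M = Monoid monoid
  private module G = Group group
  open G using (_∙_; _⁻¹)
  open GroupIdentities group

  MO : ℤ → Mat₂ → Set r₂
  MO m A = Entrywise (λ x _ → O m x) A A

  MO-resp : ∀ {m A B} → A ≋ B → MO m A → MO m B
  MO-resp p q = entrywise (O-resp (p₁₁ p) (p₁₁ q)) (O-resp (p₁₂ p) (p₁₂ q))
    (O-resp (p₂₁ p) (p₂₁ q)) (O-resp (p₂₂ p) (p₂₂ q))

  MO-· : ∀ {m n l A B} → m ℤ.+ n ≡ l → MO m A → MO n B → MO l (A · B)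
  MO-· e p q = entrywise
    (O-+ (O-*≡ e (p₁₁ p) (p₁₁ q)) (O-*≡ e (p₁₂ p) (p₂₁ q)))
    (O-+ (O-*≡ e (p₁₁ p) (p₁₂ q)) (O-*≡ e (p₁₂ p) (p₂₂ q)))
    (O-+ (O-*≡ e (p₂₁ p) (p₁₁ q)) (O-*≡ e (p₂₂ p) (p₂₁ q)))
    (O-+ (O-*≡ e (p₂₁ p) (p₁₂ q)) (O-*≡ e (p₂₂ p) (p₂₂ q)))

  σM : Mat₂ → Mat₂
  σM (mat a b c d) = mat (σ a) (σ b) (σ c) (σ d)

  σM-cong : ∀ {A B} → A ≋ B → σM A ≋ σM B
  σM-cong p = entrywise (σ-cong (p₁₁ p)) (σ-cong (p₁₂ p)) (σ-cong (p₂₁ p)) (σ-cong (p₂₂ p))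

  σM-· : ∀ A B → σM (A · B) ≋ σM A · σM B
  σM-· A B = entrywise σ-dot σ-dot σ-dot σ-dot
    where
    σ-dot : ∀ {a b c d} → σ (a * b + c * d) ≈ σ a * σ b + σ c * σ d
    σ-dot = trans (σ-+ _ _) (+-cong (σ-* _ _) (σ-* _ _))

  MO-σM : ∀ {m A} → MO m A → MO m (σM A)
  MO-σM p = entrywise (σ-O (p₁₁ p)) (σ-O (p₁₂ p)) (σ-O (p₂₁ p)) (σ-O (p₂₂ p))

  -- Since σ fixes H, g ↦ g σ(g)⁻¹ sends u g h to u (g σ(g)⁻¹) σ(u)⁻¹, so the least
  -- valuation of its entries is an invariant of K g H.
  τ : Unit → Mat₂
  τ g = val g · σM (inv g)

  -- Multiplication by u and by σ(u)⁻¹, both integral, cannot lower the least valuation. The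
  -- converse bound arises by using this with u⁻¹ and h⁻¹.
  MO-τ : ∀ {m} x u g h → K u → H h → x G.≈ u ∙ g ∙ h → MO m (τ g) → MO m (τ x)
  MO-τ {m} x u g h u∈ h∈ p q = MO-resp (M.sym eq)
    (MO-· (ℤ.+-identityˡ m) (proj₁ u∈) (MO-· (ℤ.+-identityʳ m) q (MO-σM (proj₂ u∈))))
    where
    open SetoidReasoning M.setoid
    U = val u
    A = val g
    A′ = σM (inv g)
    U′ = σM (inv u)
    B = val h
    B′ = inv h
    fixed : σM B′ ≋ B′
    fixed = entrywise (S⇒fixed (p₁₁ (proj₂ h∈))) (S⇒fixed (p₁₂ (proj₂ h∈)))
      (S⇒fixed (p₂₁ (proj₂ h∈))) (S⇒fixed (p₂₂ (proj₂ h∈)))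
    eq : τ x ≋ U · (τ g · U′)
    eq = begin
      val x · σM (inv x)
        ≈⟨ M.∙-cong p (σM-cong (G.⁻¹-cong {x} {u ∙ g ∙ h} p)) ⟩
      ((U · A) · B) · σM (B′ · (inv g · inv u))
        ≈⟨ M.∙-congˡ (M.trans (σM-· B′ (inv g · inv u)) (M.∙-cong fixed (σM-· (inv g) (inv u)))) ⟩
      ((U · A) · B) · (B′ · (A′ · U′))
        ≈⟨ M.assoc (U · A) B (B′ · (A′ · U′)) ⟩
      (U · A) · (B · (B′ · (A′ · U′)))
        ≈⟨ M.∙-congˡ (M.trans (M.sym (M.assoc B B′ (A′ · U′)))
             (M.trans (M.∙-congʳ (rightInverse h)) (M.identityˡ (A′ · U′)))) ⟩
      (U · A) · (A′ · U′)
        ≈⟨ M.assoc U A (A′ · U′) ⟩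
      U · (A · (A′ · U′))
        ≈⟨ M.∙-congˡ (M.sym (M.assoc A A′ U′)) ⟩
      U · ((A · A′) · U′)
        ∎

  -- τ(Π_b) is upper triangular with diagonal entries 1 and (-1)^b and upper right entry (-1)^b 2
  -- z^(1-b); moreover 1 - b ≤ 0.
  τΠ∈ : ∀ {b} → 1ℤ ℤ.≤ b → MO (1ℤ ℤ.- b) (τ (Π b))
  τΠ∈ {b} 1≤b = entrywise
    (O-+ (O-antitone 1-b≤0 (O-* (O-zp 0ℤ) (σ-O (O-zp 0ℤ))))
        (O-*≡ (ex₁ b) (O-zp 1ℤ) (σ-O (O-0 {ℤ.- b}))))
    (O-+ (O-*≡ (ex₂ b) (O-zp 0ℤ) (σ-O (O-neg (O-* (O-* (O-zp 0ℤ) (O-zp 1ℤ)) (O-zp (ℤ.- b))))))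
         (O-* (O-zp 1ℤ) (σ-O (O-zp (ℤ.- b)))))
    (O-+ (O-*≡ (ℤ.+-identityˡ _) (O-0 {0ℤ}) (σ-O (O-antitone 1-b≤0 (O-zp 0ℤ))))
         (O-*≡ (ex₃ b) (O-zp b) (σ-O O-0)))
    (O-+ (O-*≡ (ℤ.+-identityˡ _) (O-0 {0ℤ})
        (σ-O (O-neg (O-* (O-* (O-zp 0ℤ) (O-zp 1ℤ)) (O-zp (ℤ.- b))))))
         (O-antitone 1-b≤0 (O-*≡ (ℤ.+-inverseʳ b) (O-zp b) (σ-O (O-zp (ℤ.- b))))))
    where
    1-b≤0 : 1ℤ ℤ.- b ℤ.≤ 0ℤ
    1-b≤0 = ℤ.i≤j⇒i-j≤0 1≤b
    ex₁ : ∀ b → + 1 ℤ.+ (ℤ.- b) ≡ + 1 ℤ.- b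
    ex₁ = ℤ-Solver.solve-∀
    ex₂ : ∀ b → + 0 ℤ.+ (+ 0 ℤ.+ + 1 ℤ.+ (ℤ.- b)) ≡ + 1 ℤ.- b
    ex₂ = ℤ-Solver.solve-∀
    ex₃ : ∀ b → b ℤ.+ (+ 1 ℤ.- b ℤ.- b) ≡ + 1 ℤ.- b
    ex₃ = ℤ-Solver.solve-∀

  τΠ-sharp : ∀ {b m} → MO m (τ (Π b)) → m ℤ.≤ 1ℤ ℤ.- b
  -- Applying -σ turns the upper right entry into 2 z^(1-b) for either parity of b, so no sign has
  -- to be followed.
  τΠ-sharp {b} {m} p = O-2z^ (O-resp eq (O-neg (σ-O (p₁₂ p))))
    where
    zb′ = zp (ℤ.- b)
    Z₀ = zp 0ℤ
    eq : - σ (Z₀ * σ (- (Z₀ * z * zb′)) + z * σ zb′) ≈ zp (1ℤ ℤ.- b) + zp (1ℤ ℤ.- b)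
    eq = trans (-‿cong (trans (σ-+ _ _) (+-cong
           (trans (σ-* _ _) (*-cong (trans (σ-cong zp-0) σ-1)
               (trans (σ-σ _) (-‿cong (*-congʳ (trans (*-congʳ zp-0) (*-identityˡ z)))))))
           (trans (σ-* _ _) (*-cong σ-z (σ-σ zb′))))))
         (trans (solve 2 (λ z y → :- (con (+ 1) :* (:- (z :* y)) :+ (:- z) :* y) :=
             z :* y :+ z :* y) refl z zb′)
         (+-cong (zp-+ 1ℤ (ℤ.- b)) (zp-+ 1ℤ (ℤ.- b))))

  -- The bound 1 - b′ for τ(Π_b′) passes to τ(x) and from there to τ(Π_b), where no bound above 1 -
  -- b can hold.
  KΠH-≤ : ∀ {b b′} x → 1ℤ ℤ.≤ b′ → (K ⟨ Π b ⟩ H) x → (K ⟨ Π b′ ⟩ H) x → b ℤ.≤ b′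
  KΠH-≤ {b} {b′} x 1≤b′ (u , h , u∈ , h∈ , p) (u′ , h′ , u′∈ , h′∈ , p′) =
    ≡.subst₂ ℤ._≤_ (ex b) (ex b′) (ℤ.+-monoˡ-≤ 1ℤ (ℤ.neg-mono-≤ (τΠ-sharp {b} {1ℤ ℤ.- b′}
      (MO-τ (Π b) (u ⁻¹) x (h ⁻¹) (proj₂ u∈ , proj₁ u∈) (proj₂ h∈ , proj₁ h∈) (move x u (Π b) h p)
        (MO-τ x u′ (Π b′) h′ u′∈ h′∈ p′ (τΠ∈ 1≤b′))))))
    where
    ex : ∀ b → ℤ.- (+ 1 ℤ.- b) ℤ.+ + 1 ≡ b
    ex = ℤ-Solver.solve-∀

  KΠH-disjoint : ∀ {b b′} x → 1ℤ ℤ.≤ b → 1ℤ ℤ.≤ b′ → (K ⟨ Π b ⟩ H) x → (K ⟨ Π b′ ⟩ H) x → b ≡ b′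
  KΠH-disjoint x 1≤b 1≤b′ p q = ℤ.≤-antisym (KΠH-≤ x 1≤b′ p q) (KΠH-≤ x 1≤b q p)

-- Representatives for the cosets of K in K diag(z^(-ℓ), 1) K

module Cosets {r₁ r₂} {R : CommutativeRing r₁ r₂} (F : LaurentField R) where
  open CommutativeRing R
  open LaurentField F
  open LaurentFieldProperties F
  open IntegerCoefficients R
  open Determinants R
  open GL₂Properties F
  open Matrices R
  private module G = Group group
  open G using (_∙_; _⁻¹)
  open GroupIdentities group

  K-resp : ∀ g h → g G.≈ h → K g → K h
  K-resp g h p (A∈ , B∈) =
    entrywise (O-resp (p₁₁ p) (p₁₁ A∈)) (O-resp (p₁₂ p) (p₁₂ A∈)) (O-resp (p₂₁ p) (p₂₁ A∈))
        (O-resp (p₂₂ p) (p₂₂ A∈)) ,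
    entrywise (O-resp (p₁₁ q) (p₁₁ B∈)) (O-resp (p₁₂ q) (p₁₂ B∈)) (O-resp (p₂₁ q) (p₂₁ B∈))
        (O-resp (p₂₂ q) (p₂₂ B∈))
    where q = G.⁻¹-cong {g} {h} p

  K-⁻¹ : ∀ g → K g → K (g ⁻¹)
  K-⁻¹ g (A∈ , B∈) = B∈ , A∈

  K-∙ : ∀ g h → K g → K h → K (g ∙ h)
  K-∙ g h (A∈ , B∈) (A′∈ , B′∈) = prod A∈ A′∈ , prod B′∈ B∈
    where
    prod : ∀ {A B} → Entrywise (λ x _ → O 0ℤ x) A A → Entrywise (λ x _ → O 0ℤ x) B B →
      Entrywise (λ x _ → O 0ℤ x) (A · B) (A · B)
    prod p q = entrywise
      (O-+ (O-* (p₁₁ p) (p₁₁ q)) (O-* (p₁₂ p) (p₂₁ q)))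
      (O-+ (O-* (p₁₁ p) (p₁₂ q)) (O-* (p₁₂ p) (p₂₂ q)))
      (O-+ (O-* (p₂₁ p) (p₁₁ q)) (O-* (p₂₂ p) (p₂₁ q)))
      (O-+ (O-* (p₂₁ p) (p₁₂ q)) (O-* (p₂₂ p) (p₂₂ q)))

  ⟨⟩-resp : ∀ {A B} s g h → g G.≈ h → (A ⟨ s ⟩ B) g → (A ⟨ s ⟩ B) h
  ⟨⟩-resp s g h p (u , v , u∈ , v∈ , q) = u , v , u∈ , v∈ ,
      G.trans {h} {g} {u ∙ s ∙ v} (G.sym {g} {h} p) q

  ⟨⟩-cong : ∀ {A B} s s′ g → s G.≈ s′ → (A ⟨ s ⟩ B) g → (A ⟨ s′ ⟩ B) g
  ⟨⟩-cong s s′ g p (u , v , u∈ , v∈ , q) = u , v , u∈ , v∈ ,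
    G.trans {g} {u ∙ s ∙ v} {u ∙ s′ ∙ v} q
      (G.∙-congʳ {v} {u ∙ s} {u ∙ s′} (G.∙-congˡ {u} {s} {s′} p))

  K-⟨⟩ : ∀ {B} s u g → K u → (K ⟨ s ⟩ B) g → (K ⟨ s ⟩ B) (u ∙ g)
  K-⟨⟩ s u g u∈ (w , v , w∈ , v∈ , q) = u ∙ w , v , K-∙ u w u∈ w∈ , v∈ ,
    G.trans {u ∙ g} {u ∙ (w ∙ s ∙ v)} {u ∙ w ∙ s ∙ v} (G.∙-congˡ {u} {g} {w ∙ s ∙ v} q)
      (G.trans {u ∙ (w ∙ s ∙ v)} {u ∙ (w ∙ s) ∙ v} {u ∙ w ∙ s ∙ v}
          (G.sym {u ∙ (w ∙ s) ∙ v} {u ∙ (w ∙ s ∙ v)} (G.assoc u (w ∙ s) v))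
        (G.∙-congʳ {v} {u ∙ (w ∙ s)} {u ∙ w ∙ s} (G.sym {u ∙ w ∙ s} {u ∙ (w ∙ s)} (G.assoc u w s))))

  -- ρ t v i stands for the coset (ρ t v i)⁻¹ K.
  ρ : ℕ → Carrier → ℕ → Unit
  ρ t v i = triangular (+ t) (- v) (+ i)

  δ : ℤ → Unit
  δ ℓ = diag (ℤ.- ℓ) 0ℤ

  zp-divide : ∀ m x → x ≈ zp m * (zp (ℤ.- m) * x)
  zp-divide m x = trans (sym (*-identityˡ x)) (trans (*-congʳ (sym (zp-inverse m))) (*-assoc _ _ _))

  -- Says that z does not divide the matrix (z^t, -v; 0, z^i), so that its elementary divisors are 1
  -- and z^(t+i).
  Primitive : ℕ → ℕ → Carrier → Set (r₁ ⊔ r₂)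
  Primitive t i v = t ≡ 0 ⊎ i ≡ 0 ⊎ ∃ λ y → O 0ℤ y × v * y ≈ 1#

  O-det : ∀ {A} → Entrywise (λ x _ → O 0ℤ x) A A → O 0ℤ (det A)
  O-det p = O-+ (O-* (p₁₁ p) (p₂₂ p)) (O-neg (O-* (p₁₂ p) (p₂₁ p)))

  O-det-upper : ∀ {m n l a b d} → m ℤ.+ n ≡ l → O m a → O n d → O l (det (mat a b 0# d))
  O-det-upper e a∈ d∈ = O-+ (O-*≡ e a∈ d∈) (O-neg (O-resp (sym (zeroʳ _)) O-0))

  -- δ divides the first column of ρ u by z^ℓ. With a = u₁₁ and u₂₁ = z^t e that column consists of
  -- z^t (a - v e) and z^(i+t) e, both divisible by z^ℓ. The determinant is a unit since det ρ = z^ℓ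
  -- cancels det δ.
  ρuδ∈K : ∀ t i u {v e} → let ℓ = + t ℤ.+ + i in K u → O 0ℤ v → O 0ℤ e →
    e₂₁ (val u) ≈ zp (+ t) * e → O (+ i) (e₁₁ (val u) - v * e) → K (ρ t v i ∙ (u ∙ δ ℓ))
  ρuδ∈K t i u {v} {e} u∈@(A∈ , B∈) v∈ e∈ u₂₁ u₁₁ = 𝒪.det∈⇒GL₂ (ρ t v i ∙ (u ∙ δ ℓ))
    (entrywise
      (O-resp (sym (modulo (- v * Z) u₂₁ (solve 8 (λ y v Z e a b c d →
          y :* (a :* Z :+ b :* con (+ 0)) :+ (:- v) :* (c :* Z :+ d :* con (+ 0))
            := Z :* (y :* (a :- v :* e)) :+ (:- v) :* Z :* (c :- y :* e))
                refl (zp (+ t)) v Z e a b c d)))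
        (O-*≡ (ex₁ (+ t) (+ i)) (O-zp (ℤ.- ℓ)) (O-* (O-zp (+ t)) u₁₁)))
      (O-+ (O-* (O-zp₀ t) (col₂ (p₁₁ A∈) (p₁₂ A∈))) (O-* (O-neg v∈) (col₂ (p₂₁ A∈) (p₂₂ A∈))))
      (O-resp (sym (modulo (zp (+ i) * Z) u₂₁ (solve 8 (λ y x Z e a b c d →
          con (+ 0) :* (a :* Z :+ b :* con (+ 0)) :+ x :* (c :* Z :+ d :* con (+ 0))
            := Z :* (x :* (y :* e)) :+ x :* Z :* (c :- y :* e))
                refl (zp (+ t)) (zp (+ i)) Z e a b c d)))
        (O-*≡ (ex₂ (+ t) (+ i)) (O-zp (ℤ.- ℓ)) (O-* (O-zp (+ i)) (O-* (O-zp (+ t)) e∈))))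
      (O-+ (O-* (O-0 {0ℤ}) (col₂ (p₁₁ A∈) (p₁₂ A∈))) (O-* (O-zp₀ i) (col₂ (p₂₁ A∈) (p₂₂ A∈)))))
    (O-resp (sym (trans (det-· (inv (δ ℓ) · inv u) (inv (ρ t v i)))
        (*-congʳ (det-· (inv (δ ℓ)) (inv u)))))
      (O-*≡ (ex₃ (+ t) (+ i))
        (O-* (O-det-upper ≡.refl (O-zp (ℤ.- (ℤ.- ℓ))) (O-zp 0ℤ)) (O-det B∈))
        (O-det-upper ≡.refl (O-zp (ℤ.- + t)) (O-zp (ℤ.- + i)))))
    where
    ℓ = + t ℤ.+ + i
    Z = zp (ℤ.- ℓ)
    open Mat₂ (val u) renaming (e₁₁ to a; e₁₂ to b; e₂₁ to c; e₂₂ to d)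
    col₂ : ∀ {x y} → O 0ℤ x → O 0ℤ y → O 0ℤ (x * 0# + y * zp 0ℤ)
    col₂ x∈ y∈ = O-+ (O-* x∈ (O-0 {0ℤ})) (O-* y∈ (O-zp 0ℤ))
    ex₁ : ∀ t i → ℤ.- (t ℤ.+ i) ℤ.+ (t ℤ.+ i) ≡ + 0
    ex₁ = ℤ-Solver.solve-∀
    ex₂ : ∀ t i → ℤ.- (t ℤ.+ i) ℤ.+ (i ℤ.+ (t ℤ.+ + 0)) ≡ + 0
    ex₂ = ℤ-Solver.solve-∀
    ex₃ : ∀ t i → ℤ.- (ℤ.- (t ℤ.+ i)) ℤ.+ + 0 ℤ.+ + 0 ℤ.+ (ℤ.- t ℤ.+ ℤ.- i) ≡ + 0
    ex₃ = ℤ-Solver.solve-∀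

  -- t is the valuation of c = u₂₁ cut off at ℓ. Below the cut-off c = z^t e with e a unit, and v =
  -- a / e makes a - v e vanish; at the cut-off i = 0, and v = 0 will do.
  reduce : ∀ ℓ u → K u → ∃ λ t → ∃ λ i → ∃ λ v →
    t ℕ.+ i ≡ ℓ × O 0ℤ v × Primitive t i v × K (ρ t v i ∙ (u ∙ δ (+ ℓ)))
  reduce ℓ u u∈@(A∈ , B∈) with order (p₂₁ A∈) ℓ
  ... | inj₁ c∈ = ℓ , 0 , 0# , ℕ.+-identityʳ ℓ , O-0 , inj₂ (inj₁ ≡.refl) ,
    ≡.subst (λ n → K (ρ ℓ 0# 0 ∙ (u ∙ δ (+ n)))) (ℕ.+-identityʳ ℓ)
      (ρuδ∈K ℓ 0 u u∈ O-0 e∈ (zp-divide (+ ℓ) c) (O-+ (p₁₁ A∈) (O-neg (O-* (O-0 {0ℤ}) e∈))))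
    where
    c = e₂₁ (val u)
    e∈ : O 0ℤ (zp (ℤ.- + ℓ) * c)
    e∈ = O-*≡ (ℤ.+-inverseˡ (+ ℓ)) (O-zp (ℤ.- + ℓ)) c∈
  ... | inj₂ (t , t<ℓ , c∈ , c∉) = t , i , v , t+i≡ℓ , v∈ , v-primitive t c∈ ,
    ≡.subst (λ n → K (ρ t v i ∙ (u ∙ δ (+ n)))) t+i≡ℓ
      (ρuδ∈K t i u u∈ v∈ e∈ (zp-divide (+ t) c) (O-resp (sym a-ve≈0) O-0))
    where
    i = ℓ ℕ.∸ t
    t+i≡ℓ : t ℕ.+ i ≡ ℓ
    t+i≡ℓ = ℕ.m+[n∸m]≡n (ℕ.<⇒≤ t<ℓ)
    a = e₁₁ (val u)
    c = e₂₁ (val u)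
    e = zp (ℤ.- + t) * c
    e∈ : O 0ℤ e
    e∈ = O-*≡ (ℤ.+-inverseˡ (+ t)) (O-zp (ℤ.- + t)) c∈
    e-unit : ∃ λ y → O 0ℤ y × e * y ≈ 1#
    e-unit = unit e∈ λ e∈₁ → c∉ (O-resp (sym (zp-divide (+ t) c))
      (O-*≡ (≡.cong +_ (ℕ.+-comm t 1)) (O-zp (+ t)) e∈₁))
    y = proj₁ e-unit
    ey≈1 = proj₂ (proj₂ e-unit)
    v = a * y
    v∈ : O 0ℤ v
    v∈ = O-* (p₁₁ A∈) (proj₁ (proj₂ e-unit))
    a-ve≈0 : a - v * e ≈ 0#
    a-ve≈0 = modulo (- a) ey≈1 (solve 3 (λ a y e →
      a :- a :* y :* e := con (+ 0) :+ :- a :* (e :* y :- con (+ 1))) refl a y e)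
    v-primitive : ∀ t → O (+ t) c → Primitive t i v
    v-primitive zero    _  = inj₁ ≡.refl
    v-primitive (suc t) c∈ = inj₂ (inj₂ (a⁻¹ * e , O-* (proj₁ (proj₂ a-unit)) e∈ ,
      trans (solve 4 (λ a y a⁻¹ e → a :* y :* (a⁻¹ :* e) := (a :* a⁻¹) :* (e :* y)) refl a y a⁻¹ e)
        (*-one (proj₂ (proj₂ a-unit)) ey≈1)))
      where
      a-unit : ∃ λ x → O 0ℤ x × a * x ≈ 1#
      -- For t > 0 already z divides c. If z divided a as well, it would divide the entry 1 of u⁻¹
      -- u.
      a-unit = unit (p₁₁ A∈) λ a∈₁ → 1∉O₁ (O-resp (p₁₁ (leftInverse u))
        (O-+ (O-* (p₁₁ B∈) a∈₁) (O-* (p₁₂ B∈) (O-antitone (+≤+ (s≤s z≤n)) c∈))))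
      a⁻¹ = proj₁ a-unit

  KδK⇒ρ : ∀ ℓ y → (K ⟨ δ (+ ℓ) ⟩ K) y → ∃ λ t → ∃ λ i → ∃ λ v →
    t ℕ.+ i ≡ ℓ × O 0ℤ v × Primitive t i v × K (ρ t v i ∙ y)
  KδK⇒ρ ℓ y (u , w , u∈ , w∈ , eq) with reduce ℓ u u∈
  ... | t , i , v , p , v∈ , prim , ρuδ = t , i , v , p , v∈ , prim ,
    K-resp (ρ t v i ∙ (u ∙ δ (+ ℓ)) ∙ w) (ρ t v i ∙ y)
      (G.trans {ρ t v i ∙ (u ∙ δ (+ ℓ)) ∙ w} {ρ t v i ∙ (u ∙ δ (+ ℓ) ∙ w)} {ρ t v i ∙ y}
        (G.assoc (ρ t v i) (u ∙ δ (+ ℓ)) w)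
        (G.∙-congˡ {ρ t v i} {u ∙ δ (+ ℓ) ∙ w} {y} (G.sym {y} {u ∙ δ (+ ℓ) ∙ w} eq)))
      (K-∙ (ρ t v i ∙ (u ∙ δ (+ ℓ))) w ρuδ w∈)

  -- By ρuδ∈K it suffices that (v , z^t) is the first column of u.
  primitive-column : ∀ t i v → O 0ℤ v → Primitive t i v → ∃ λ u →
      K u × K (ρ t v i ∙ (u ∙ δ (+ (t ℕ.+ i))))
  primitive-column t i v v∈ (inj₁ ≡.refl) = u , u∈ , ρuδ∈K 0 i u u∈ v∈ O-1
      (sym (trans (*-identityʳ _) zp-0))
      (O-resp (sym (trans (+-congˡ (-‿cong (*-identityʳ v))) (-‿inverseʳ v))) O-0)
    where
    u-det : det (mat v (- 1#) 1# 0#) * 1# ≈ 1#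
    u-det = (solve 1 (λ v → (v :* con (+ 0) :- (:- con (+ 1)) :* con (+ 1)) :* con (+ 1) :=
        con (+ 1)) refl v)
    u = fromDet (mat v (- 1#) 1# 0#) 1# u-det
    u∈ : K u
    u∈ = 𝒪.fromDet∈GL₂ u-det v∈ (O-neg O-1) O-1 O-0 O-1
  primitive-column t i v v∈ (inj₂ (inj₁ ≡.refl)) = u , u∈ , ρuδ∈K t 0 u u∈ v∈ O-0
      (sym (zeroʳ _)) (O-+ O-1 (O-neg (O-* v∈ (O-0 {0ℤ}))))
    where
    u-det : det (mat 1# 0# 0# 1#) * 1# ≈ 1#
    u-det = (solve 0 ((con (+ 1) :* con (+ 1) :- con (+ 0) :* con (+ 0)) :* con (+ 1) :=
        con (+ 1)) refl)
    u = fromDet (mat 1# 0# 0# 1#) 1# u-det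
    u∈ : K u
    u∈ = 𝒪.fromDet∈GL₂ u-det O-1 O-0 O-0 O-1 O-1
  primitive-column t i v v∈ (inj₂ (inj₂ (y , y∈ , vy≈1))) = u , u∈ , ρuδ∈K t i u u∈ v∈ O-1
      (sym (*-identityʳ _))
      (O-resp (sym (trans (+-congˡ (-‿cong (*-identityʳ v))) (-‿inverseʳ v))) O-0)
    where
    u-det : det (mat v 0# (zp (+ t)) y) * 1# ≈ 1#
    u-det = (trans (solve 3 (λ v y z → (v :* y :- con (+ 0) :* z) :* con (+ 1) := v :* y)
        refl v y (zp (+ t))) vy≈1)
    u = fromDet (mat v 0# (zp (+ t)) y) 1# u-det
    u∈ : K u
    u∈ = 𝒪.fromDet∈GL₂ u-det v∈ O-0 (O-zp₀ t) y∈ O-1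

  -- y = u δ · (ρ u δ)⁻¹ (ρ y), and both ρ u δ and ρ y lie in K.
  ρ⇒KδK : ∀ t i v y → O 0ℤ v → Primitive t i v → K (ρ t v i ∙ y) → (K ⟨ δ (+ (t ℕ.+ i)) ⟩ K) y
  ρ⇒KδK t i v y v∈ prim ρy with primitive-column t i v v∈ prim
  ... | u , u∈ , ρuδ = u , (r ∙ a) ⁻¹ ∙ (r ∙ y) , u∈ ,
    K-∙ ((r ∙ a) ⁻¹) (r ∙ y) (K-⁻¹ (r ∙ a) ρuδ) ρy , factor r a y
    where
    r = ρ t v i
    a = u ∙ δ (+ (t ℕ.+ i))

  1≤a+i-t : ∀ t i a → + (t ℕ.+ i) ℤ.< a ℤ.- 1ℤ → 1ℤ ℤ.≤ a ℤ.+ (+ i ℤ.- + t)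
  1≤a+i-t t i a ℓ<a-1 = ≡.subst (1ℤ ℤ.≤_) (ex (+ t) (+ i) a)
    (ℤ.+-monoˡ-≤ 1ℤ (ℤ.+-mono-≤ (ℤ.i≤j⇒0≤j-i (ℤ.i<j⇒suc[i]≤j ℓ<a-1)) (+≤+ z≤n)))
    where
    ex : ∀ t i a → a ℤ.- + 1 ℤ.- (+ 1 ℤ.+ (t ℤ.+ i)) ℤ.+ (+ 1 ℤ.+ i ℤ.+ i) ℤ.+ + 1 ≡ a ℤ.+ (i ℤ.- t)
    ex = ℤ-Solver.solve-∀

  -- The exponent in 1 - p = v z^(a-t-1) for the p of `ρ⇒KΠH`. As t may be as large as ℓ, its
  -- positivity for all t is exactly ℓ < a - 1.
  1≤a-t-1 : ∀ t i a → + (t ℕ.+ i) ℤ.< a ℤ.- 1ℤ → 1ℤ ℤ.≤ a ℤ.- + t ℤ.- 1ℤ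
  1≤a-t-1 t i a ℓ<a-1 = ≡.subst (1ℤ ℤ.≤_) (ex (+ t) (+ i) a)
    (ℤ.+-monoˡ-≤ 1ℤ (ℤ.+-mono-≤ (ℤ.i≤j⇒0≤j-i (ℤ.i<j⇒suc[i]≤j ℓ<a-1)) (+≤+ {0} {i} z≤n)))
    where
    ex : ∀ t i a → a ℤ.- + 1 ℤ.- (+ 1 ℤ.+ (t ℤ.+ i)) ℤ.+ i ℤ.+ + 1 ≡ a ℤ.- t ℤ.- + 1
    ex = ℤ-Solver.solve-∀

  -- ρ y ∈ K carries y⁻¹ Π_a to ρ Π_a, whose upper right entry is z^(t+1) - v z^a = z^(t+1) p.
  -- Comparing z^(a+i) with z^(t+b) gives b.
  ρ⇒KΠH : ∀ t i v y a → O 0ℤ v → + (t ℕ.+ i) ℤ.< a ℤ.- 1ℤ → K (ρ t v i ∙ y) →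
    (K ⟨ Π (a ℤ.+ (+ i ℤ.- + t)) ⟩ H) (y ⁻¹ ∙ Π a)
  ρ⇒KΠH t i v y a v∈ ℓ<a-1 ρy = ⟨⟩-resp (Π b) ((r ∙ y) ⁻¹ ∙ (r ∙ Π a)) (y ⁻¹ ∙ Π a)
      (\\-common r y (Π a))
    (K-⟨⟩ (Π b) ((r ∙ y) ⁻¹) (r ∙ Π a) (K-⁻¹ (r ∙ y) ρy)
      (KΠH-triangular {p} {b} (1≤a+i-t t i a ℓ<a-1) p-1∈ t (r ∙ Π a) (entrywise
        (trans (+-congʳ (*-congˡ zp-0))
            (solve 2 (λ v y → y :* con (+ 1) :+ :- v :* con (+ 0) := y) refl v (zp (+ t))))
        (modulo v zts≈za (solve 5 (λ v y z s x →
          y :* z :+ :- v :* x := y :* (z :* (con (+ 1) :- v :* s)) :+ v :* (y :* z :* s :- x))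
              refl v (zp (+ t)) z s (zp a)))
        (solve 2 (λ x y → con (+ 0) :* x :+ y :* con (+ 0) := con (+ 0)) refl (zp 0ℤ) (zp (+ i)))
        (trans (solve 3 (λ x y z → con (+ 0) :* z :+ x :* y := x :* y) refl (zp (+ i)) (zp a) z)
          (zp-*≡ (ex₁ (+ t) (+ i) a))))))
    where
    r = ρ t v i
    b = a ℤ.+ (+ i ℤ.- + t)
    s = zp (a ℤ.- + t ℤ.- 1ℤ)
    p = 1# - v * s
    ex₁ : ∀ t i a → i ℤ.+ a ≡ t ℤ.+ (a ℤ.+ (i ℤ.- t))
    ex₁ = ℤ-Solver.solve-∀
    ex₂ : ∀ t a → t ℤ.+ + 1 ℤ.+ (a ℤ.- t ℤ.- + 1) ≡ a
    ex₂ = ℤ-Solver.solve-∀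
    p-1∈ : O 1ℤ (p - 1#)
    p-1∈ = O-resp (solve 2 (λ v s → :- (v :* s) := con (+ 1) :- v :* s :- con (+ 1)) refl v s)
      (O-neg (O-* v∈ (O-antitone (1≤a-t-1 t i a ℓ<a-1) (O-zp (a ℤ.- + t ℤ.- 1ℤ)))))
    zts≈za : zp (+ t) * z * s ≈ zp a
    zts≈za = trans (*-congʳ (zp-+ (+ t) 1ℤ)) (zp-*≡ (ex₂ (+ t) a))

  -- The other entries of ρ(v) ρ(v′)⁻¹ are those of the identity, so this entry alone decides
  -- whether v and v′ give the same coset.
  ρρ⁻¹₁₂ : ∀ t i v v′ → e₁₂ (val (ρ t v i ∙ ρ t v′ i ⁻¹)) ≈ zp (ℤ.- + i) * (v′ - v)
  ρρ⁻¹₁₂ t i v v′ = modulo (v′ * zp (ℤ.- + i)) (zp-inverse (+ t)) (solve 5 (λ y y′ x v v′ →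
    y :* (:- (y′ :* (:- v′) :* x)) :+ (:- v) :* x :=
        x :* (v′ :- v) :+ v′ :* x :* (y :* y′ :- con (+ 1)))
    refl (zp (+ t)) (zp (ℤ.- + t)) (zp (ℤ.- + i)) v v′)

  ρ-same : ∀ t i v v′ y → O 0ℤ v → O 0ℤ v′ → O (+ i) (v′ - v) → K (ρ t v′ i ∙ y) → K (ρ t v i ∙ y)
  ρ-same t i v v′ y v∈ v′∈ v′-v∈ r′y = K-resp ((r ∙ r′ ⁻¹) ∙ (r′ ∙ y)) (r ∙ y) (through r r′ y)
    (K-∙ (r ∙ r′ ⁻¹) (r′ ∙ y) (𝒪.det∈⇒GL₂ (r ∙ r′ ⁻¹)
      (entrywise
        (O-+ (O-*≡ (ℤ.+-inverseʳ (+ t)) (O-zp (+ t)) (O-zp (ℤ.- + t))) (O-* (O-neg v∈) (O-0 {0ℤ})))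
        (O-resp (sym (ρρ⁻¹₁₂ t i v v′)) (O-*≡ (ℤ.+-inverseˡ (+ i)) (O-zp (ℤ.- + i)) v′-v∈))
        (O-+ (O-resp (sym (zeroˡ _)) O-0) (O-* (O-zp₀ i) (O-0 {0ℤ})))
        (O-+ (O-resp (sym (zeroˡ _)) O-0)
            (O-*≡ (ℤ.+-inverseʳ (+ i)) (O-zp (+ i)) (O-zp (ℤ.- + i)))))
      (O-resp (sym (det-· (val r′) (inv r))) (O-*≡ (ex (+ t) (+ i))
        (O-det-upper ≡.refl (O-zp (+ t)) (O-zp (+ i)))
        (O-det-upper ≡.refl (O-zp (ℤ.- + t)) (O-zp (ℤ.- + i)))))) r′y)
    where
    r = ρ t v i
    r′ = ρ t v′ i
    ex : ∀ t i → t ℤ.+ i ℤ.+ (ℤ.- t ℤ.+ ℤ.- i) ≡ + 0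
    ex = ℤ-Solver.solve-∀

  ρ-distinct : ∀ t i v v′ y → K (ρ t v i ∙ y) → K (ρ t v′ i ∙ y) → O (+ i) (v′ - v)
  ρ-distinct t i v v′ y ry r′y = O-resp (sym (zp-divide (+ i) (v′ - v)))
    (O-*≡ (ℤ.+-identityʳ (+ i)) (O-zp (+ i)) (O-resp (ρρ⁻¹₁₂ t i v v′) (p₁₂ (proj₁ rr′∈))))
    where
    r = ρ t v i
    r′ = ρ t v′ i
    rr′∈ : K (r ∙ r′ ⁻¹)
    rr′∈ = K-resp ((r ∙ y) ∙ (r′ ∙ y) ⁻¹) (r ∙ r′ ⁻¹) (//-common r r′ y)
      (K-∙ (r ∙ y) ((r′ ∙ y) ⁻¹) ry (K-⁻¹ (r′ ∙ y) r′y))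

-- Formal Laurent series as an instance of the abstract properties

module LaurentSeries {c e} (k : CommutativeRing c e) {q} (kF : IsFiniteField k q) (2≉0 : CharNot2 k) where
  private module k = CommutativeRing k
  open IsFiniteField kF
  open Inverse enumeration using (to; to-cong; inverseʳ)
  open Laurent k
  private module R = CommutativeRing ring
  open IntegerCoefficients k using (solve; _:=_; _:+_; _:*_; :-_; _:-_; con)
  open RingProperties k.ring using (-0#≈0#)

  _≈?_ : ∀ x y → Dec (x k.≈ y)
  x ≈? y = Dec.map′
    (λ p → k.trans (k.sym (inverseʳ ≡.refl)) (inverseʳ p))
    to-cong (to x Fin.≟ to y)

  <⇒negative : ∀ {n d} → n ℤ.< d → ∃ λ i → n ℤ.- d ≡ -[1+ i ]
  <⇒negative {n} {d} n<d with n ℤ.- d | ≡.subst (n ℤ.- d ℤ.<_) (ℤ.+-inverseʳ d)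
      (ℤ.+-monoˡ-< (ℤ.- d) n<d)
  ... | -[1+ i ] | _ = i , ≡.refl
  ... | + _      | ℤ.+<+ ()

  InPower-z^ : ∀ d a → InPower d (z^ d · a)
  InPower-z^ d a n n<d with <⇒negative n<d
  ... | i , eq = k.reflexive (≡.cong (at a) eq)

  InPower-resp : ∀ {m f g} → f ≈ g → InPower m f → InPower m g
  InPower-resp p f∈ n n<m = k.trans (k.sym (coeff-≈ p n)) (f∈ n n<m)

  -- `ord f` is not the valuation, as leading coefficients may vanish. This representative starts at
  -- m, so that `*` adds the bounds.
  InPower⇒z^ : ∀ {m f} → InPower m f → f ≈ (z^ m · λ i → coeff f (m ℤ.+ + i))
  InPower⇒z^ {m} {f} f∈ = coeffwise eq
    where
    ex : ∀ n m → m ℤ.+ (n ℤ.- m) ≡ n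
    ex = ℤ-Solver.solve-∀
    eq : ∀ n → coeff f n k.≈ at (λ i → coeff f (m ℤ.+ + i)) (n ℤ.- m)
    eq n with n ℤ.- m in p
    ... | + i      = k.reflexive
          (≡.cong (coeff f) (≡.trans (≡.sym (ex n m)) (≡.cong (λ x → m ℤ.+ x) p)))
    ... | -[1+ i ] = f∈ n (ℤ.≰⇒> λ m≤n → contradiction (≡.subst (0ℤ ℤ.≤_) p (ℤ.i≤j⇒0≤j-i m≤n)) λ ())

  InPower-+ : ∀ {m f g} → InPower m f → InPower m g → InPower m (f + g)
  InPower-+ {f = f} {g} f∈ g∈ n n<m =
    k.trans (coeff-+ f g n) (k.trans (k.+-cong (f∈ n n<m) (g∈ n n<m)) (k.+-identityˡ k.0#))

  InPower-neg : ∀ {m f} → InPower m f → InPower m (- f)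
  InPower-neg {f = f} f∈ n n<m = k.trans (coeff-neg f n) (k.trans (k.-‿cong (f∈ n n<m)) -0#≈0#)

  InPower-* : ∀ {m n f g} → InPower m f → InPower n g → InPower (m ℤ.+ n) (f * g)
  InPower-* {m} {n} {f} {g} f∈ g∈ = InPower-resp {m ℤ.+ n}
    (R.sym (*-cong {f} {_} {g} {_} (InPower⇒z^ f∈) (InPower⇒z^ g∈))) (InPower-z^ (m ℤ.+ n) _)

  InPower-suc : ∀ {m f} → InPower m f → coeff f m k.≈ k.0# → InPower (ℤ.suc m) f
  InPower-suc {m} {f} f∈ p n n<1+m with ℤ.<-cmp n m
  ... | tri< n<m _ _    = f∈ n n<m
  ... | tri≈ _ ≡.refl _ = p
  ... | tri> _ _ m<n    = contradiction (ℤ.<-≤-trans n<1+m (ℤ.i<j⇒suc[i]≤j m<n)) (ℤ.<-irrefl ≡.refl)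

  order : ∀ {f} → InPower 0ℤ f → ∀ n →
    InPower (+ n) f ⊎ ∃ λ t → t ℕ.< n × InPower (+ t) f × ¬ InPower (+ suc t) f
  order f∈ zero = inj₁ f∈
  order {f} f∈ (suc n) with order f∈ n
  ... | inj₂ (t , t<n , t∈ , t∉) = inj₂ (t , ℕ.m<n⇒m<1+n t<n , t∈ , t∉)
  ... | inj₁ n∈ with coeff f (+ n) ≈? k.0#
  ...   | yes p = inj₁ (InPower-suc n∈ p)
  ...   | no ¬p = inj₂ (n , ℕ.n<1+n n , n∈ , λ n∈′ → ¬p (n∈′ (+ n) (ℤ.+<+ (ℕ.n<1+n n))))

  coeff-zpow : ∀ n → coeff (zpow n) n k.≈ k.1#
  coeff-zpow n = k.reflexive (≡.cong (at one) (ℤ.+-inverseʳ n))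

  O-2zpow : ∀ {m n} → InPower m (zpow n + zpow n) → m ℤ.≤ n
  O-2zpow {m} {n} p = ℤ.≮⇒≥ λ n<m → 2≉0 (k.trans
    (k.+-cong (k.sym (coeff-zpow n)) (k.sym (coeff-zpow n)))
    (k.trans (k.sym (coeff-+ (zpow n) (zpow n) n)) (p n n<m)))

  -- Long division: quotient r = r / a.
  module _ (a : Series) (u : k.Carrier) (a₀u≈1 : a 0 k.* u k.≈ k.1#) where

    quotient : Series → Series
    quotient r zero    = r 0 k.* u
    quotient r (suc n) = quotient (λ i → r (suc i) k.- r 0 k.* u k.* a (suc i)) n

    conv-quotient : ∀ r → conv a (quotient r) ≗ r
    conv-quotient r zero =
        k.trans (solve 3 (λ a r u → a :* (r :* u) := r :* (a :* u)) k.refl (a 0) (r 0) u)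
      (k.trans (k.*-congˡ a₀u≈1) (k.*-identityʳ _))
    conv-quotient r (suc n) = k.trans (conv-sucʳ a (quotient r) n)
      (k.trans (k.+-congˡ (conv-quotient _ n))
        (solve 3 (λ a x r → a :* x :+ (r :- x :* a) := r) k.refl (a (suc n)) (r 0 k.* u)
            (r (suc n))))

  unit : ∀ {f} → InPower 0ℤ f → ¬ InPower 1ℤ f → ∃ λ g → InPower 0ℤ g × f * g ≈ R.1#
  unit {f} f∈ f∉ = (z^ 0ℤ · b) , InPower-z^ 0ℤ b ,
    R.trans (*-congʳ (z^ 0ℤ · b) (InPower⇒z^ f∈)) (z^-congʳ 0ℤ (conv-quotient a u p one))
    where
    a : Series
    a i = coeff f (0ℤ ℤ.+ + i)
    a₀ = invertible (a 0) (λ p → f∉ (InPower-suc f∈ p))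
    u = proj₁ a₀
    p = proj₂ a₀
    b = quotient a u p one

  sgnℕ : ℕ → k.Carrier
  sgnℕ zero    = k.1#
  sgnℕ (suc n) = k.- sgnℕ n

  -- The sign (-1)^n, as n and its absolute value have the same parity.
  sgn : ℤ → k.Carrier
  sgn n = sgnℕ ℤ.∣ n ∣

  sgnℕ-+ : ∀ m n → sgnℕ (m ℕ.+ n) k.≈ sgnℕ m k.* sgnℕ n
  sgnℕ-+ zero    n = k.sym (k.*-identityˡ _)
  sgnℕ-+ (suc m) n = k.trans (k.-‿cong (sgnℕ-+ m n))
    (solve 2 (λ x y → :- (x :* y) := :- x :* y) k.refl (sgnℕ m) (sgnℕ n))

  sgn-⊖ : ∀ m n → sgn (m ⊖ n) k.≈ sgnℕ m k.* sgnℕ n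
  sgn-⊖ zero    zero    = k.sym (k.*-identityˡ _)
  sgn-⊖ zero    (suc n) = k.sym (k.*-identityˡ _)
  sgn-⊖ (suc m) zero    = k.sym (k.*-identityʳ _)
  sgn-⊖ (suc m) (suc n) = k.trans (k.reflexive (≡.cong sgn (ℤ.[1+m]⊖[1+n]≡m⊖n m n)))
    (k.trans (sgn-⊖ m n) (solve 2 (λ x y → x :* y := :- x :* :- y) k.refl (sgnℕ m) (sgnℕ n)))

  sgn-+ : ∀ m n → sgn (m ℤ.+ n) k.≈ sgn m k.* sgn n
  sgn-+ (+ m)    (+ n)    = sgnℕ-+ m n
  sgn-+ (+ m)    -[1+ n ] = sgn-⊖ m (suc n)
  sgn-+ -[1+ m ] (+ n)    = k.trans (sgn-⊖ n (suc m)) (k.*-comm _ _)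
  sgn-+ -[1+ m ] -[1+ n ] =
      k.trans (k.reflexive (≡.cong (λ x → sgnℕ (suc x)) (≡.sym (ℕ.+-suc m n))))
    (sgnℕ-+ (suc m) (suc n))

  sgn² : ∀ n → sgn n k.* sgn n k.≈ k.1#
  sgn² n = square ℤ.∣ n ∣
    where
    square : ∀ n → sgnℕ n k.* sgnℕ n k.≈ k.1#
    square zero    = k.*-identityˡ _
    square (suc n) = k.trans (solve 1 (λ x → :- x :* :- x := x :* x) k.refl (sgnℕ n)) (square n)

  sgn-parity : ∀ n → (+ 2 ℤ.∣ n × sgn n k.≈ k.1#) ⊎ (¬ (+ 2 ℤ.∣ n) × sgn n k.≈ k.- k.1#)
  sgn-parity n = parity ℤ.∣ n ∣
    where
    parity : ∀ n → (2 ℕ.∣ n × sgnℕ n k.≈ k.1#) ⊎ (¬ (2 ℕ.∣ n) × sgnℕ n k.≈ k.- k.1#)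
    parity zero = inj₁ (2 ℕ.∣0 , k.refl)
    parity (suc zero) = inj₂ ((λ p → contradiction (ℕ.∣1⇒≡1 p) λ ()) , k.refl)
    parity (suc (suc n)) with parity n
    ... | inj₁ (p , s) = inj₁ (ℕ.∣m∣n⇒∣m+n ℕ.∣-refl p ,
      k.trans (solve 1 (λ x → :- (:- x) := x) k.refl (sgnℕ n)) s)
    ... | inj₂ (p , s) = inj₂ ((λ p′ → p (ℕ.∣m+n∣m⇒∣n p′ ℕ.∣-refl)) ,
      k.trans (solve 1 (λ x → :- (:- x) := x) k.refl (sgnℕ n)) s)

  σ : L → L
  σ f = z^ ord f · λ i → sgn (ord f ℤ.+ + i) k.* series f i

  coeff-σ : ∀ f n → coeff (σ f) n k.≈ sgn n k.* coeff f n
  coeff-σ f n with n ℤ.- ord f in eq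
  ... | + i      = k.*-congʳ (k.reflexive (≡.cong sgn
          (≡.trans (≡.cong (λ x → ord f ℤ.+ x) (≡.sym eq)) (ex n (ord f)))))
    where
    ex : ∀ n m → m ℤ.+ (n ℤ.- m) ≡ n
    ex = ℤ-Solver.solve-∀
  ... | -[1+ i ] = k.sym (k.zeroʳ _)

  conv-sgn : ∀ d d′ a b i →
    conv (λ i → sgn (d ℤ.+ + i) k.* a i) (λ i → sgn (d′ ℤ.+ + i) k.* b i) i
      k.≈ sgn (d ℤ.+ d′ ℤ.+ + i) k.* conv a b i
  conv-sgn d d′ a b i = go d a i
    where
    b′ : Series
    b′ i = sgn (d′ ℤ.+ + i) k.* b i
    head : ∀ d a i → sgn (d ℤ.+ 0ℤ) k.* a 0 k.* b′ i k.≈ sgn (d ℤ.+ d′ ℤ.+ + i) k.* (a 0 k.* b i)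
    head d a i = k.trans
      (solve 4 (λ s a s′ b → s :* a :* (s′ :* b) := s :* s′ :* (a :* b)) k.refl (sgn (d ℤ.+ 0ℤ))
          (a 0) (sgn (d′ ℤ.+ + i)) (b i))
      (k.*-congʳ (k.trans (k.sym (sgn-+ (d ℤ.+ 0ℤ) (d′ ℤ.+ + i)))
          (k.reflexive (≡.cong sgn (ex d d′ (+ i))))))
      where
      ex : ∀ d d′ i → d ℤ.+ + 0 ℤ.+ (d′ ℤ.+ i) ≡ d ℤ.+ d′ ℤ.+ i
      ex = ℤ-Solver.solve-∀
    -- Passing to the tail of a moves its first exponent to d + 1, so d has to vary in the
    -- induction.
    go : ∀ d a i → conv (λ i → sgn (d ℤ.+ + i) k.* a i) b′ i k.≈ sgn
        (d ℤ.+ d′ ℤ.+ + i) k.* conv a b i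
    go d a zero    = head d a zero
    go d a (suc i) = k.trans (k.+-cong (head d a (suc i))
      (k.trans (conv-cong (λ j → k.*-congʳ (k.reflexive (≡.cong sgn (ex₁ d (+ j)))))
          (λ _ → k.refl) i)
        (k.trans (go (d ℤ.+ 1ℤ) (tail a) i)
          (k.*-congʳ (k.reflexive (≡.cong sgn (ex₂ d d′ (+ i))))))))
      (k.sym (k.distribˡ _ _ _))
      where
      ex₁ : ∀ d j → d ℤ.+ (+ 1 ℤ.+ j) ≡ d ℤ.+ + 1 ℤ.+ j
      ex₁ = ℤ-Solver.solve-∀
      ex₂ : ∀ d d′ i → d ℤ.+ + 1 ℤ.+ d′ ℤ.+ i ≡ d ℤ.+ d′ ℤ.+ (+ 1 ℤ.+ i)
      ex₂ = ℤ-Solver.solve-∀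

  σ-cong : ∀ {f g} → f ≈ g → σ f ≈ σ g
  σ-cong {f} {g} p = coeffwise λ n →
    k.trans (coeff-σ f n) (k.trans (k.*-congˡ (coeff-≈ p n)) (k.sym (coeff-σ g n)))

  σ-+ : ∀ f g → σ (f + g) ≈ σ f + σ g
  σ-+ f g = coeffwise λ n → k.trans (coeff-σ (f + g) n) (k.trans (k.*-congˡ (coeff-+ f g n))
    (k.trans (k.distribˡ _ _ _) (k.trans (k.+-cong (k.sym (coeff-σ f n)) (k.sym (coeff-σ g n)))
      (k.sym (coeff-+ (σ f) (σ g) n)))))

  σ-* : ∀ f g → σ (f * g) ≈ σ f * σ g
  σ-* f g = z^-congʳ (ord f ℤ.+ ord g)
    λ i → k.sym (conv-sgn (ord f) (ord g) (series f) (series g) i)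

  σ-neg : ∀ f → σ (- f) ≈ - σ f
  σ-neg f = coeffwise λ n → k.trans (coeff-σ (- f) n) (k.trans (k.*-congˡ (coeff-neg f n))
    (k.trans (solve 2 (λ x y → x :* :- y := :- (x :* y)) k.refl (sgn n) (coeff f n))
      (k.trans (k.-‿cong (k.sym (coeff-σ f n))) (k.sym (coeff-neg (σ f) n)))))

  σ-σ : ∀ f → σ (σ f) ≈ f
  σ-σ f = coeffwise λ n → k.trans (coeff-σ (σ f) n) (k.trans (k.*-congˡ (coeff-σ f n))
    (k.trans (k.sym (k.*-assoc _ _ _)) (k.trans (k.*-congʳ (sgn² n)) (k.*-identityˡ _))))

  σ-z : σ (zpow 1ℤ) ≈ - zpow 1ℤ
  σ-z = coeffwise λ n → k.trans (coeff-σ (zpow 1ℤ) n)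
    (k.trans (odd n (n ℤ.- 1ℤ) ≡.refl) (k.sym (coeff-neg (zpow 1ℤ) n)))
    where
    ex : ∀ n → n ≡ n ℤ.- + 1 ℤ.+ + 1
    ex = ℤ-Solver.solve-∀
    odd : ∀ n m → n ℤ.- 1ℤ ≡ m → sgn n k.* at one m k.≈ k.- at one m
    odd n (+ zero) p = k.trans (k.*-identityʳ _)
        (k.reflexive (≡.cong sgn (≡.trans (ex n) (≡.cong (ℤ._+ 1ℤ) p))))
    odd n (+ suc i) p = k.trans (k.zeroʳ _) (k.sym -0#≈0#)
    odd n -[1+ i ]  p = k.trans (k.zeroʳ _) (k.sym -0#≈0#)

  σ-InPower : ∀ {m f} → InPower m f → InPower m (σ f)
  σ-InPower {f = f} f∈ n n<m = k.trans (coeff-σ f n) (k.trans (k.*-congˡ (f∈ n n<m)) (k.zeroʳ _))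

  half : ∃ λ h → (k.1# k.+ k.1#) k.* h k.≈ k.1#
  half = invertible (k.1# k.+ k.1#) 2≉0

  h : k.Carrier
  h = proj₁ half

  h+h≈1 : h k.+ h k.≈ k.1#
  h+h≈1 = k.trans (solve 1 (λ h → h :+ h := (con (+ 1) :+ con (+ 1)) :* h) k.refl h) (proj₂ half)

  InSquares⇒fixed : ∀ {f} → InSquares f → σ f ≈ f
  InSquares⇒fixed {f} f∈ = coeffwise λ n → k.trans (coeff-σ f n) (eq n (sgn-parity n))
    where
    eq : ∀ n → _ → sgn n k.* coeff f n k.≈ coeff f n
    eq n (inj₁ (_ , s)) = k.trans (k.*-congʳ s) (k.*-identityˡ _)
    eq n (inj₂ (odd , _)) = k.trans (k.*-congˡ (f∈ n odd)) (k.trans (k.zeroʳ _) (k.sym (f∈ n odd)))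

  -- For n odd the coefficient x satisfies x = - x, so x = h (x - (- x)) = h (x - x) with h = 1/2.
  fixed⇒InSquares : ∀ {f} → σ f ≈ f → InSquares f
  fixed⇒InSquares {f} p n odd with sgn-parity n
  ... | inj₁ (even , _) = contradiction even odd
  ... | inj₂ (_ , s) = begin
    x                          ≈⟨ k.*-identityˡ x ⟨
    k.1# k.* x                 ≈⟨ k.*-congʳ h+h≈1 ⟨
    (h k.+ h) k.* x            ≈⟨ solve 2 (λ h x → (h :+ h) :* x := h :* (x :- :- con (+ 1) :* x))
        k.refl h x ⟩
    h k.* (x k.- k.- k.1# k.* x)
      ≈⟨ k.*-congˡ (k.+-congˡ
          (k.-‿cong (k.trans (k.*-congʳ (k.sym s))
          (k.trans (k.sym (coeff-σ f n)) (coeff-≈ p n))))) ⟩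
    h k.* (x k.- x)            ≈⟨ solve 2 (λ h x → h :* (x :- x) := con (+ 0)) k.refl h x ⟩
    k.0#                       ∎
    where
    open SetoidReasoning k.setoid
    x = coeff f n

  InSquares-zpow : ∀ m → InSquares (zpow (m ℤ.+ m))
  InSquares-zpow m n odd with n ℤ.- (m ℤ.+ m) in eq
  ... | + suc _  = k.refl
  ... | -[1+ _ ] = k.refl
  ... | + zero   = contradiction (Signed.∣⇒∣ᵤ (Signed.divides m
          (≡.trans (ex₁ n m) (≡.trans (≡.cong (λ x → x ℤ.+ (m ℤ.+ m)) eq) (ex₂ m))))) odd
    where
    ex₁ : ∀ n m → n ≡ n ℤ.- (m ℤ.+ m) ℤ.+ (m ℤ.+ m)
    ex₁ = ℤ-Solver.solve-∀
    ex₂ : ∀ m → + 0 ℤ.+ (m ℤ.+ m) ≡ m ℤ.* + 2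
    ex₂ = ℤ-Solver.solve-∀

  constant : k.Carrier → Series
  constant x zero    = x
  constant x (suc _) = k.0#

  ½ : L
  ½ = z^ 0ℤ · constant h

  laurentField : LaurentField (Laurent.ring k)
  laurentField = record
    { O = InPower
    ; O-resp = λ {m} → InPower-resp {m}
    ; O-0 = λ n _ → coeff-0L n
    ; O-+ = InPower-+
    ; O-neg = InPower-neg
    ; O-* = InPower-*
    ; O-antitone = λ m≤n f∈ i i<m → f∈ i (ℤ.<-≤-trans i<m m≤n)
    ; zp = zpow
    ; zp-+ = zpow-+
    ; zp-0 = R.refl
    ; zp-inverse = GL₂k⟮⟮z⟯⟯.zpow-inverse k
    ; O-zp = λ m → InPower-z^ m one
    ; unit = unit
    ; order = order
    ; O-2z^ = O-2zpow
    ; S = InSquares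
    ; S-zp = InSquares-zpow
    ; σ = σ
    ; σ-cong = σ-cong
    ; σ-+ = σ-+
    ; σ-* = σ-*
    ; σ-neg = σ-neg
    ; σ-σ = σ-σ
    ; σ-z = σ-z
    ; σ-O = σ-InPower
    ; S⇒fixed = InSquares⇒fixed
    ; fixed⇒S = fixed⇒InSquares
    ; ½ = ½
    ; ½+½ = R.trans (z^-+ 0ℤ (constant h) (constant h))
        (z^-congʳ 0ℤ λ { zero → h+h≈1 ; (suc _) → k.+-identityˡ _ })
    ; O-½ = InPower-z^ 0ℤ (constant h)
    ; σ-½ = z^-congʳ 0ℤ λ { zero → k.*-identityˡ _ ; (suc _) → k.zeroʳ _ }
    }

-- Integration over finite unions of cosets of K

module CosetIntegral {c e p} (𝓖 : Group c e) (K : Group.Carrier 𝓖 → Set p)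
  (U : ℕ → Group.Carrier 𝓖 → Set p) (U₀⊆K : ∀ g → U 0 g → K g) (K? : ∀ g → Dec (K g))
  (K-resp : ∀ g h → Group._≈_ 𝓖 g h → K g → K h)
  (K-∙ : ∀ g h → K g → K h → K (Group._∙_ 𝓖 g h))
  (K-⁻¹ : ∀ g → K g → K (Group._⁻¹ 𝓖 g)) where

  private module G = Group 𝓖
  open G using (_≈_; _∙_; _⁻¹; ε) renaming (Carrier to G)
  open GroupProperties 𝓖 using (\\-leftDividesˡ; ⁻¹-involutive; x≈z//y)
  open GroupIdentities 𝓖
  open Haar 𝓖 K U
  open TestFunction

  1ᴷ : G → ℚ
  1ᴷ g with K? g
  ... | yes _ = 1ℚ
  ... | no  _ = 0ℚ

  1ᴷ≡1 : ∀ g → K g → 1ᴷ g ≡ 1ℚ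
  1ᴷ≡1 g g∈ with K? g
  ... | yes _  = ≡.refl
  ... | no  g∉ = contradiction g∈ g∉

  1ᴷ≡0 : ∀ g → ¬ K g → 1ᴷ g ≡ 0ℚ
  1ᴷ≡0 g g∉ with K? g
  ... | yes g∈ = contradiction g∈ g∉
  ... | no  _  = ≡.refl

  1ᴷ-cong : ∀ g h → K (g ⁻¹ ∙ h) → 1ᴷ g ≡ 1ᴷ h
  1ᴷ-cong g h d with K? g
  ... | yes g∈ = ≡.sym (1ᴷ≡1 h (K-resp _ _ (\\-leftDividesˡ g h) (K-∙ g _ g∈ d)))
  ... | no  g∉ = ≡.sym (1ᴷ≡0 h λ h∈ → g∉ (K-resp _ _ (G.sym (x≈z//y g _ h (\\-leftDividesˡ g h)))
                   (K-∙ h _ h∈ (K-⁻¹ _ d))))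

  -- The number of the cosets (r x)⁻¹ K that contain y.
  count : ∀ {N} → (Fin N → G) → G → ℚ
  count {zero}  r y = 0ℚ
  count {suc N} r y = 1ᴷ (r zero ∙ y) ℚ.+ count (r ∘ suc) y

  count≡0 : ∀ {N} (r : Fin N → G) y → (∀ x → ¬ K (r x ∙ y)) → count r y ≡ 0ℚ
  count≡0 {zero}  r y none = ≡.refl
  count≡0 {suc N} r y none =
    ≡.cong₂ ℚ._+_ (1ᴷ≡0 (r zero ∙ y) (none zero)) (count≡0 (r ∘ suc) y (none ∘ suc))

  Distinct : ∀ {N} → (Fin N → G) → Set _
  Distinct r = ∀ x x′ y → K (r x ∙ y) → K (r x′ ∙ y) → x ≡ x′

  count≡1 : ∀ {N} (r : Fin N → G) → Distinct r → ∀ x y → K (r x ∙ y) → count r y ≡ 1ℚ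
  count≡1 {suc N} r dist zero y y∈ = ≡.cong₂ ℚ._+_ (1ᴷ≡1 (r zero ∙ y) y∈)
    (count≡0 (r ∘ suc) y λ x y∈′ → contradiction (dist zero (suc x) y y∈ y∈′) λ ())
  count≡1 {suc N} r dist (suc x) y y∈ = ≡.cong₂ ℚ._+_
    (1ᴷ≡0 (r zero ∙ y) λ y∈′ → contradiction (dist zero (suc x) y y∈′ y∈) λ ())
    (count≡1 (r ∘ suc) (λ x x′ y p q → Fin-suc-injective (dist (suc x) (suc x′) y p q)) x y y∈)
    where
    Fin-suc-injective : ∀ {n} {i j : Fin n} → Fin.suc i ≡ suc j → i ≡ j
    Fin-suc-injective ≡.refl = ≡.refl

  test-1ᴷ∘ : ∀ r → TestFunction (λ y → 1ᴷ (r ∙ y))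
  test-1ᴷ∘ r = record
    -- The function is right invariant under K, and K contains U 0.
    { level = 0
    ; locallyConstant = λ g h u → 1ᴷ-cong (r ∙ g) (r ∙ h)
        (K-resp _ _ (G.sym (\\-common r g h)) (U₀⊆K _ u))
    ; support = r ⁻¹ ∷ []
    ; compactlySupported = λ g f≢0 → here (supp g f≢0)
    }
    where
    supp : ∀ g → ¬ 1ᴷ (r ∙ g) ≡ 0ℚ → K (r ⁻¹ ⁻¹ ∙ g)
    supp g f≢0 with K? (r ∙ g)
    ... | yes p = K-resp _ _ (G.∙-congʳ (G.sym (⁻¹-involutive r))) p
    ... | no  _ = contradiction ≡.refl f≢0

  test-resp : ∀ {f g} → (∀ y → f y ≡ g y) → TestFunction f → TestFunction g
  test-resp f≗g t = record
    { level = level t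
    ; locallyConstant = λ x y u →
        ≡.trans (≡.sym (f≗g x)) (≡.trans (locallyConstant t x y u) (f≗g y))
    ; support = support t
    ; compactlySupported = λ y g≢0 → compactlySupported t y λ f≡0 →
        g≢0 (≡.trans (≡.sym (f≗g y)) f≡0)
    }

  test-1ᴷ : TestFunction 1ᴷ
  test-1ᴷ = test-resp (λ y → 1ᴷ-resp (G.identityˡ y)) (test-1ᴷ∘ ε)
    where
    1ᴷ-resp : ∀ {g h} → g ≈ h → 1ᴷ g ≡ 1ᴷ h
    1ᴷ-resp {g} {h} p with K? g
    ... | yes g∈ = ≡.sym (1ᴷ≡1 h (K-resp g h p g∈))
    ... | no  g∉ = ≡.sym (1ᴷ≡0 h λ h∈ → g∉ (K-resp h g (G.sym p) h∈))

  test-count : ∀ {N} (r : Fin N → G) → TestFunction (count r)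
  test-count {N} r = record
    { level = 0
    ; locallyConstant = λ g h u → local r g h (U₀⊆K _ u)
    ; support = supp r
    ; compactlySupported = compact r
    }
    where
    local : ∀ {N} (r : Fin N → G) g h → K (g ⁻¹ ∙ h) → count r g ≡ count r h
    local {zero}  r g h d = ≡.refl
    local {suc N} r g h d = ≡.cong₂ ℚ._+_
      (1ᴷ-cong (r zero ∙ g) (r zero ∙ h) (K-resp _ _ (G.sym (\\-common (r zero) g h)) d))
      (local (r ∘ suc) g h d)
    supp : ∀ {N} → (Fin N → G) → List G
    supp {zero}  r = []
    supp {suc N} r = r zero ⁻¹ ∷ supp (r ∘ suc)
    compact : ∀ {N} (r : Fin N → G) g → ¬ count r g ≡ 0ℚ → Any (λ s → K (s ⁻¹ ∙ g)) (supp r)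
    compact {zero}  r g f≢0 = contradiction ≡.refl f≢0
    compact {suc N} r g f≢0 with K? (r zero ∙ g)
    ... | yes p = here (K-resp _ _ (G.∙-congʳ (G.sym (⁻¹-involutive (r zero)))) p)
    ... | no  _ = there (compact (r ∘ suc) g λ p → f≢0 (≡.trans (ℚ.+-identityˡ _) p))

  -- Reduction by a gcd does not compute for a variable n; among unnormalised rationals this is an
  -- equation of integers.
  1+n/1 : ∀ n → 1ℚ ℚ.+ (+ n ℚ./ 1) ≡ + suc n ℚ./ 1
  1+n/1 n = ℚ.toℚᵘ-injective (begin
    ℚ.toℚᵘ (1ℚ ℚ.+ (+ n ℚ./ 1))             ≈⟨ ℚ.toℚᵘ-homo-+ 1ℚ (+ n ℚ./ 1) ⟩
    ℚᵘ.1ℚᵘ ℚᵘ.+ ℚ.toℚᵘ (+ n ℚ./ 1)          ≈⟨ ℚᵘ.+-congʳ ℚᵘ.1ℚᵘ (ℚ.toℚᵘ-fromℚᵘ (ℚᵘ.mkℚᵘ (+ n) 0)) ⟩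
    ℚᵘ.1ℚᵘ ℚᵘ.+ ℚᵘ.mkℚᵘ (+ n) 0             ≈⟨ ℚᵘ.*≡* (ex (+ n)) ⟩
    ℚᵘ.mkℚᵘ (+ suc n) 0                     ≈⟨ ℚ.toℚᵘ-fromℚᵘ (ℚᵘ.mkℚᵘ (+ suc n) 0) ⟨
    ℚ.toℚᵘ (+ suc n ℚ./ 1)                  ∎)
    where
    open ℚᵘ.≃-Reasoning
    ex : ∀ n → (+ 1 ℤ.* + 1 ℤ.+ n ℤ.* + 1) ℤ.* + 1 ≡ (+ 1 ℤ.+ n) ℤ.* + 1
    ex = ℤ-Solver.solve-∀

  module _ (μ : HaarIntegral) where

    ∫1ᴷ∘ : ∀ r → ∫ μ (λ y → 1ᴷ (r ∙ y)) (test-1ᴷ∘ r) ≡ 1ℚ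
    ∫1ᴷ∘ r = ≡.trans (leftInvariant μ r test-1ᴷ (test-1ᴷ∘ r)) (normalised μ test-1ᴷ char)
      where
      char : IsCharacteristic K 1ᴷ
      char g with K? g
      ... | yes g∈ = inj₁ (g∈ , ≡.refl)
      ... | no  g∉ = inj₂ (g∉ , ≡.refl)

    ∫count : ∀ {N} (r : Fin N → G) → ∫ μ (count r) (test-count r) ≡ + N ℚ./ 1
    -- That the zero function has integral 0 is deduced from homogeneity, by writing it as 0 · 1ᴷ.
    ∫count {zero} r = ≡.trans (cong μ (test-count r) zero·1ᴷ (λ y → ≡.sym (ℚ.*-zeroˡ (1ᴷ y))))
      (≡.trans (homogeneous μ 0ℚ test-1ᴷ zero·1ᴷ) (ℚ.*-zeroˡ (∫ μ 1ᴷ test-1ᴷ)))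
      where
      zero·1ᴷ : TestFunction (λ y → 0ℚ ℚ.* 1ᴷ y)
      zero·1ᴷ = test-resp (λ y → ≡.sym (ℚ.*-zeroˡ (1ᴷ y))) (test-count r)
    ∫count {suc N} r = ≡.trans
        (additive μ (test-1ᴷ∘ (r zero)) (test-count (r ∘ suc)) (test-count r))
      (≡.trans (≡.cong₂ ℚ._+_ (∫1ᴷ∘ (r zero)) (∫count (r ∘ suc))) (1+n/1 N))

    cosets-integral : ∀ {N} (r : Fin N → G) → Distinct r → ∀ f →
      (∀ y → (∃ λ x → K (r x ∙ y) × f y ≡ 1ℚ) ⊎ ((∀ x → ¬ K (r x ∙ y)) × f y ≡ 0ℚ)) →
      HasIntegral μ f (+ N ℚ./ 1)
    cosets-integral r dist f values = t , ≡.trans (cong μ t (test-count r) (≡.sym ∘ count≗f))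
        (∫count r)
      where
      count≗f : ∀ y → count r y ≡ f y
      count≗f y with values y
      ... | inj₁ (x , y∈ , f≡1)  = ≡.trans (count≡1 r dist x y y∈) (≡.sym f≡1)
      ... | inj₂ (none , f≡0)    = ≡.trans (count≡0 r y none) (≡.sym f≡0)
      t : TestFunction f
      t = test-resp count≗f (test-count r)

-- The structure constant as a number of cosets

open import Data.Integer using (_+_; _-_; _*_; -_; _^_; _≤_; _<_; ∣_∣)
open import Data.Integer.DivMod using (_/_)
open import Data.Integer.Divisibility using (_∣_)

-- Π and δ need to agree with the matrices above only up to ≈, so that proofs of
-- invertibility are never compared.
module Counting {r₁ r₂} {R : CommutativeRing r₁ r₂} (F : LaurentField R)
  (U : ℕ → Matrices.Unit R → Set r₂) (U₀⊆K : ∀ g → U 0 g → GL₂Properties.K F g)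
  (K? : ∀ g → Dec (GL₂Properties.K F g))
  (Π δ : ℤ → Matrices.Unit R)
  (Π≈ : ∀ b → Group._≈_ (Matrices.group R) (Π b) (GL₂Properties.Π F b))
  (δ≈ : ∀ ℓ → Group._≈_ (Matrices.group R) (δ ℓ) (Cosets.δ F ℓ)) where
  open CommutativeRing R using (Carrier) renaming (_-_ to _-ᴿ_)
  open LaurentField F using (O)
  open Matrices R using (Unit; group)
  private module G = Group group
  open G using (_∙_; _⁻¹)
  private module P = GL₂Properties F
  open P using (K; H; _⟨_⟩_)
  open Disjointness F using (KΠH-disjoint)
  open Cosets F hiding (δ)
  open Haar group K U
  open CosetIntegral group K U U₀⊆K K? K-resp K-∙ K-⁻¹ using (cosets-integral)

  -- N is then the number of cosets ρ⁻¹ K with the given t and i.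
  record Representatives (t i N : ℕ) : Set (r₁ ⊔ r₂) where
    field
      rep       : Fin N → Carrier
      integral  : ∀ x → O 0ℤ (rep x)
      isPrimitive : ∀ x → Primitive t i (rep x)
      injective : ∀ x x′ → O (+ i) (rep x′ -ᴿ rep x) → x ≡ x′
      complete  : ∀ v → O 0ℤ v → Primitive t i v → ∃ λ x → O (+ i) (v -ᴿ rep x)

  -- The sum of t + i and i - t is 2 i.
  i-t-injective : ∀ t i t′ i′ → t′ ℕ.+ i′ ≡ t ℕ.+ i → + i′ - + t′ ≡ + i - + t → t′ ≡ t × i′ ≡ i
  i-t-injective t i t′ i′ p q = ℕ.+-cancelʳ-≡ i t′ t (≡.trans (≡.cong (t′ ℕ.+_) (≡.sym i′≡i)) p) ,
      i′≡i
    where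
    ex : ∀ t i → t + i + (i - t) ≡ i * + 2
    ex = ℤ-Solver.solve-∀
    i′≡i : i′ ≡ i
    i′≡i = ℤ.+-injective (ℤ.*-cancelʳ-≡ (+ i′) (+ i) (+ 2)
      (≡.trans (≡.sym (ex (+ t′) (+ i′))) (≡.trans (≡.cong₂ _+_ (≡.cong +_ p) q) (ex (+ t) (+ i)))))

  integral-counts : ∀ (μ : HaarIntegral) {t i N a} → Representatives t i N → + (t ℕ.+ i) < a - 1ℤ →
    ∀ (c d : Unit → ℚ) →
    IsCharacteristic (K ⟨ δ (+ (t ℕ.+ i)) ⟩ K) c →
        IsCharacteristic (K ⟨ Π (a + (+ i - + t)) ⟩ H) d →
    ConvolutionAt μ c d (Π a) (+ N ÷ 1)
  integral-counts μ {t} {i} {N} {a} reps ℓ<a-1 c d c-char d-char =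
    cosets-integral μ r (λ x x′ y y∈ y∈′ →
        injective x x′ (ρ-distinct t i (rep x) (rep x′) y y∈ y∈′)) f values
    where
    open Representatives reps
    open GroupProperties (AbelianGroup.group ℤ.+-0-abelianGroup) using (∙-cancelˡ)
    r : Fin N → Unit
    r x = ρ t (rep x) i
    f : Unit → ℚ
    f y = d (y ⁻¹ ∙ Π a) ℚ.* c y
    ℓ = + (t ℕ.+ i)
    b = a + (+ i - + t)
    Π⇒generic : ∀ y → (K ⟨ Π b ⟩ H) (y ⁻¹ ∙ Π a) → (K ⟨ P.Π b ⟩ H) (y ⁻¹ ∙ P.Π a)
    Π⇒generic y p = ⟨⟩-resp (P.Π b) (y ⁻¹ ∙ Π a) (y ⁻¹ ∙ P.Π a)
        (G.∙-congˡ {y ⁻¹} {Π a} {P.Π a} (Π≈ a))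
      (⟨⟩-cong (Π b) (P.Π b) (y ⁻¹ ∙ Π a) (Π≈ b) p)
    generic⇒Π : ∀ y → (K ⟨ P.Π b ⟩ H) (y ⁻¹ ∙ P.Π a) → (K ⟨ Π b ⟩ H) (y ⁻¹ ∙ Π a)
    generic⇒Π y p = ⟨⟩-resp (Π b) (y ⁻¹ ∙ P.Π a) (y ⁻¹ ∙ Π a)
      (G.∙-congˡ {y ⁻¹} {P.Π a} {Π a} (G.sym {Π a} {P.Π a} (Π≈ a)))
      (⟨⟩-cong (P.Π b) (Π b) (y ⁻¹ ∙ P.Π a) (G.sym {Π b} {P.Π b} (Π≈ b)) p)
    Value : Unit → Set _
    Value y = (∃ λ x → K (r x ∙ y) × f y ≡ 1ℚ) ⊎ ((∀ x → ¬ K (r x ∙ y)) × f y ≡ 0ℚ)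
    zeroᶜ : ∀ y → ¬ (K ⟨ δ (+ (t ℕ.+ i)) ⟩ K) y → c y ≡ 0ℚ → Value y
    zeroᶜ y y∉ c≡0 = inj₂
        ((λ x y∈ → y∉ (⟨⟩-cong (Cosets.δ F ℓ) (δ ℓ) y (G.sym {δ ℓ} {Cosets.δ F ℓ} (δ≈ ℓ))
         (ρ⇒KδK t i (rep x) y (integral x) (isPrimitive x) y∈))) ,
       ≡.trans (≡.cong (d (y ⁻¹ ∙ Π a) ℚ.*_) c≡0) (ℚ.*-zeroʳ (d (y ⁻¹ ∙ Π a))))
    zeroᵈ : ∀ y → ¬ (K ⟨ Π (a + (+ i - + t)) ⟩ H) (y ⁻¹ ∙ Π a) → d (y ⁻¹ ∙ Π a) ≡ 0ℚ → Value y
    zeroᵈ y y∉ d≡0 = inj₂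
        ((λ x y∈ → y∉ (generic⇒Π y (ρ⇒KΠH t i (rep x) y a (integral x) ℓ<a-1 y∈))) ,
       ≡.trans (≡.cong (ℚ._* c y) d≡0) (ℚ.*-zeroˡ (c y)))
    same : ∀ y t′ i′ v → t′ ≡ t × i′ ≡ i → O 0ℤ v → Primitive t′ i′ v → K (ρ t′ v i′ ∙ y) →
      ∃ λ x → K (r x ∙ y)
    same y t′ i′ v (≡.refl , ≡.refl) v∈ v-prim ρ′y =
      let x , v≡x = complete v v∈ v-prim in x , ρ-same t i (rep x) v y (integral x) v∈ v≡x ρ′y
    -- Some ρ(t′, v, i′) with t′ + i′ = t + i takes y into K, which puts y⁻¹ Π_a into K Π_b′ H for
    -- b′ = a + i′ - t′. Disjointness gives b′ = b, hence (t′, i′) = (t, i), and v may be replaced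
    -- by its representative.
    one : ∀ y → (K ⟨ δ (+ (t ℕ.+ i)) ⟩ K) y → (K ⟨ Π (a + (+ i - + t)) ⟩ H) (y ⁻¹ ∙ Π a) →
      ∃ λ x → K (r x ∙ y)
    one y y∈ ∈Π = found (KδK⇒ρ (t ℕ.+ i) y (⟨⟩-cong (δ ℓ) (Cosets.δ F ℓ) y (δ≈ ℓ) y∈))
      where
      found : (∃ λ t′ → ∃ λ i′ → ∃ λ v →
        t′ ℕ.+ i′ ≡ t ℕ.+ i × O 0ℤ v × Primitive t′ i′ v × K (ρ t′ v i′ ∙ y)) → ∃ λ x → K (r x ∙ y)
      found (t′ , i′ , v , t′+i′ , v∈ , v-prim , ρ′y) =
        same y t′ i′ v (i-t-injective t i t′ i′ t′+i′ (∙-cancelˡ a (+ i′ - + t′) (+ i - + t)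
          (KΠH-disjoint (y ⁻¹ ∙ P.Π a) (1≤a+i-t t′ i′ a ℓ′<a-1) (1≤a+i-t t i a ℓ<a-1)
            (ρ⇒KΠH t′ i′ v y a v∈ ℓ′<a-1 ρ′y) (Π⇒generic y ∈Π)))) v∈ v-prim ρ′y
        where ℓ′<a-1 = ≡.subst (λ ℓ → + ℓ < a - 1ℤ) (≡.sym t′+i′) ℓ<a-1
    values : ∀ y → Value y
    values y = value (c-char y) (d-char (y ⁻¹ ∙ Π a))
      where
      value : _ → _ → Value y
      value (inj₂ (y∉ , c≡0)) _                   = zeroᶜ y y∉ c≡0
      value (inj₁ _)          (inj₂ (y∉ , d≡0))   = zeroᵈ y y∉ d≡0
      value (inj₁ (y∈ , c≡1)) (inj₁ (∈Π , d≡1))   =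
        let x , y∈x = one y y∈ ∈Π in inj₁ (x , y∈x , ≡.cong₂ ℚ._*_ d≡1 c≡1)

-- Residues modulo z^i and their number

module StructureConstants {c e} (k : CommutativeRing c e) {p} (kF : IsFiniteField k (suc p)) (2≉0 : CharNot2 k) where
  private
    module k = CommutativeRing k
    q = suc p
  open IsFiniteField kF
  open Inverse enumeration using (to; to-cong; from; inverseʳ; inverseˡ)
  open Laurent k using (L; z^_·_; Series; coeff; coeff-+; coeff-neg; InPower; at; ord; series)
  open LaurentSeries k kF 2≉0
  open LaurentFieldProperties {R = Laurent.ring k} laurentField using (unit⇒∉O₁)
  open Cosets {R = Laurent.ring k} laurentField using (Primitive)
  open GL₂k⟮⟮z⟯⟯ k using (K; K[_]; Π; diag; HaarIntegral; StructureConstant)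
  open Matrices (Laurent.ring k) using (group; val; inv; Entrywise; entrywise)
  private module R = CommutativeRing (Laurent.ring k)

  -- Below m only the coefficients from `ord f` on can be non-zero, so finitely many are tested.
  InPower? : ∀ m f → Dec (InPower m f)
  InPower? m f = Dec.map′ from-series to-series (vanishing? (m - ord f))
    where
    Vanishing : ℤ → Set e
    Vanishing n = ∀ i → + i < n → series f i k.≈ k.0#
    vanishing? : ∀ n → Dec (Vanishing n)
    vanishing? (+ n)    = Dec.map′ (λ p i i<n → p (ℤ.drop‿+<+ i<n)) (λ p {i} i<n → p i (ℤ.+<+ i<n))
      (ℕ.allUpTo? (λ i → series f i ≈? k.0#) n)
    vanishing? -[1+ n ] = yes λ i ()
    from-series : Vanishing (m - ord f) → InPower m f
    from-series p n n<m with n - ord f in eq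
    ... | + i      = p i (≡.subst (_< m - ord f) eq (ℤ.+-monoˡ-< (- ord f) n<m))
    ... | -[1+ _ ] = k.refl
    ex₁ : ∀ d m → d + (m - d) ≡ m
    ex₁ = ℤ-Solver.solve-∀
    ex₂ : ∀ d i → d + i - d ≡ i
    ex₂ = ℤ-Solver.solve-∀
    to-series : InPower m f → Vanishing (m - ord f)
    to-series p i i<m-d = ≡.subst (λ n → at (series f) n k.≈ k.0#) (ex₂ (ord f) (+ i))
      (p (ord f + + i) (≡.subst (λ n → ord f + + i < n) (ex₁ (ord f) m)
          (ℤ.+-monoʳ-< (ord f) i<m-d)))

  K? : ∀ g → Dec (K g)
  K? g = over? (val g) Dec.×-dec over? (inv g)
    where
    over? : ∀ A → Dec (Entrywise (λ x _ → InPower 0ℤ x) A A)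
    over? (Matrices.mat a b c d) = Dec.map′
      (λ (pa , pb , pc , pd) → entrywise pa pb pc pd)
      (λ (entrywise pa pb pc pd) → pa , pb , pc , pd)
      (InPower? 0ℤ a Dec.×-dec InPower? 0ℤ b Dec.×-dec InPower? 0ℤ c Dec.×-dec InPower? 0ℤ d)

  Π≈ : ∀ b → Group._≈_ group (Π b) (GL₂Properties.Π {R = Laurent.ring k} laurentField b)
  Π≈ b = entrywise R.refl R.refl R.refl R.refl

  δ≈ : ∀ ℓ → Group._≈_ group (diag (- ℓ) 0ℤ) (Cosets.δ {R = Laurent.ring k} laurentField ℓ)
  δ≈ ℓ = entrywise R.refl R.refl R.refl R.refl

  open Counting {R = Laurent.ring k} laurentField K[_] (λ g → proj₁) K? Π
      (λ ℓ → diag (- ℓ) 0ℤ) Π≈ δ≈ public using (Representatives; integral-counts)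

  coeff-z⁰ : ∀ a n → coeff (z^ 0ℤ · a) (+ n) k.≈ a n
  coeff-z⁰ a n = k.reflexive (≡.cong (at a) (ℤ.+-identityʳ (+ n)))

  agree⇒InPower : ∀ i f a → InPower 0ℤ f → (∀ n → n ℕ.< i → coeff f (+ n) k.≈ a n) →
    InPower (+ i) (f R.- z^ 0ℤ · a)
  agree⇒InPower i f a f∈ eq n n<i =
      k.trans (coeff-+ f (R.- g) n) (k.trans (k.+-congˡ (coeff-neg g n)) (vanish n n<i))
    where
    g : L
    g = z^ 0ℤ · a
    vanish : ∀ n → n < + i → coeff f n k.- coeff g n k.≈ k.0#
    vanish (+ n)    n<i = k.trans (k.+-cong (eq n (ℤ.drop‿+<+ n<i)) (k.-‿cong (coeff-z⁰ a n)))
        (k.-‿inverseʳ _)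
    vanish -[1+ n ] n<i =
        k.trans (k.+-cong (f∈ -[1+ n ] ℤ.-<+) (k.-‿cong (InPower-z^ 0ℤ a -[1+ n ] ℤ.-<+)))
        (k.-‿inverseʳ _)

  InPower⇒agree : ∀ i a b → InPower (+ i) ((z^ 0ℤ · a) R.- (z^ 0ℤ · b)) → ∀ n → n ℕ.< i →
      a n k.≈ b n
  InPower⇒agree i a b p n n<i = k.trans (k.sym (coeff-z⁰ a n)) (k.trans
    (x∙y⁻¹≈ε⇒x≈y _ _ (k.trans (k.+-congˡ (k.sym (coeff-neg (z^ 0ℤ · b) (+ n))))
      (k.trans (k.sym (coeff-+ (z^ 0ℤ · a) (R.- (z^ 0ℤ · b)) (+ n))) (p (+ n) (ℤ.+<+ n<i)))))
    (coeff-z⁰ b n))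
    where open GroupProperties k.+-group using (x∙y⁻¹≈ε⇒x≈y)

  -- The constant coefficient has its own range d, so that it can be restricted to non-zero values
  -- when units are counted.
  prepend : ∀ {m N} → (Fin m → k.Carrier) → (Fin N → Series) → Fin (m ℕ.* N) → Series
  prepend {m} {N} d s x zero    = d (proj₁ (remQuot {m} N x))
  prepend {m} {N} d s x (suc n) = s (proj₂ (remQuot {m} N x)) n

  -- The polynomials of degree less than i, indexed by expansions in base q; they represent k[[z]]
  -- modulo z^i.
  digits : ∀ i → Fin (q ℕ.^ i) → Series
  digits zero    _ _ = k.0#
  digits (suc i)     = prepend from (digits i)

  Separating : ∀ i {N} → (Fin N → Series) → Set e
  Separating i s = ∀ x x′ → (∀ n → n ℕ.< i → s x n k.≈ s x′ n) → x ≡ x′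

  prepend-separating : ∀ {m N i} {d : Fin m → k.Carrier} {s : Fin N → Series} →
    (∀ a b → d a k.≈ d b → a ≡ b) → Separating i s → Separating (suc i) (prepend d s)
  prepend-separating {m} {N} d-inj s-sep x x′ eq = begin
    x                                     ≡⟨ Fin.combine-remQuot {m} N x ⟨
    uncurry combine (remQuot {m} N x)     ≡⟨ ≡.cong₂ combine (d-inj _ _ (eq 0 (s≤s z≤n)))
                                               (s-sep _ _ λ n n<i → eq (suc n) (s≤s n<i)) ⟩
    uncurry combine (remQuot {m} N x′)    ≡⟨ Fin.combine-remQuot {m} N x′ ⟩
    x′                                    ∎
    where open ≡.≡-Reasoning

  prepend-complete : ∀ {m N i} {d : Fin m → k.Carrier} {s : Fin N → Series} (a : Series) →
    (∃ λ x → a 0 k.≈ d x) → (∃ λ y → ∀ n → n ℕ.< i → a (suc n) k.≈ s y n) →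
    ∃ λ x → ∀ n → n ℕ.< suc i → a n k.≈ prepend d s x n
  prepend-complete {m} {N} {i} {d} {s} a (x , p) (y , r) = combine x y , agree
    where
    agree : ∀ n → n ℕ.< suc i → a n k.≈ prepend d s (combine x y) n
    agree zero    _         =
        k.trans p (k.reflexive (≡.cong (d ∘ proj₁) (≡.sym (Fin.remQuot-combine {m} {N} x y))))
    agree (suc n) (s≤s n<i) = k.trans (r n n<i)
      (k.reflexive (≡.cong (λ xy → s (proj₂ xy) n) (≡.sym (Fin.remQuot-combine {m} {N} x y))))

  from-injective : ∀ a b → from a k.≈ from b → a ≡ b
  from-injective a b p = ≡.trans (≡.sym (inverseˡ k.refl)) (≡.trans (to-cong p) (inverseˡ k.refl))

  from-surjective : ∀ x → ∃ λ a → x k.≈ from a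
  from-surjective x = to x , k.sym (inverseʳ ≡.refl)

  digits-separating : ∀ i → Separating i (digits i)
  digits-separating zero    zero zero _ = ≡.refl
  digits-separating (suc i)             = prepend-separating from-injective (digits-separating i)

  digits-complete : ∀ i (a : Series) → ∃ λ x → ∀ n → n ℕ.< i → a n k.≈ digits i x n
  digits-complete zero    a = zero , λ n ()
  digits-complete (suc i) a =
    prepend-complete {i = i} {from} {digits i} a (from-surjective (a 0))
        (digits-complete i (λ n → a (suc n)))

  -- Writing q as suc p lets `Fin p` index the q - 1 non-zero elements, once the index of 0 is left
  -- out.
  nonzero : Fin p → k.Carrier
  nonzero a = from (punchIn (to k.0#) a)

  nonzero≉0 : ∀ a → ¬ nonzero a k.≈ k.0#
  nonzero≉0 a eq = Fin.punchInᵢ≢i (to k.0#) a (≡.trans (≡.sym (inverseˡ k.refl)) (to-cong eq))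

  nonzero-surjective : ∀ x → ¬ x k.≈ k.0# → ∃ λ a → x k.≈ nonzero a
  nonzero-surjective x x≉0 = punchOut 0≢x , k.trans (proj₂ (from-surjective x))
      (k.reflexive (≡.cong from (≡.sym (Fin.punchIn-punchOut 0≢x))))
    where
    0≢x : ¬ to k.0# ≡ to x
    0≢x eq = x≉0 (k.trans (k.sym (inverseʳ ≡.refl)) (inverseʳ (≡.sym eq)))

  representatives : ∀ t i {N} (s : Fin N → Series) → Separating i s →
    (∀ x → Primitive t i (z^ 0ℤ · s x)) →
    (∀ v → Primitive t i v → InPower 0ℤ v → ∃ λ x → ∀ n → n ℕ.< i → coeff v (+ n) k.≈ s x n) →
    Representatives t i N
  representatives t i s sep prim comp = record
    { rep = λ x → z^ 0ℤ · s x
    ; integral = λ x → InPower-z^ 0ℤ (s x)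
    ; isPrimitive = prim
    ; injective = λ x x′ x′-x∈ → sep x x′ λ n n<i → k.sym (InPower⇒agree i (s x′) (s x) x′-x∈ n n<i)
    ; complete = λ v v∈ v-prim → let x , eq = comp v v-prim v∈ in x , agree⇒InPower i v (s x) v∈ eq
    }

  representatives-t0 : ∀ i → Representatives 0 i (q ℕ.^ i)
  representatives-t0 i = representatives 0 i (digits i) (digits-separating i) (λ _ → inj₁ ≡.refl)
    λ v _ _ → digits-complete i (λ n → coeff v (+ n))

  representatives-i0 : ∀ t → Representatives t 0 1
  representatives-i0 t = representatives t 0 (digits 0) (digits-separating 0)
      (λ _ → inj₂ (inj₁ ≡.refl))
    λ v _ _ → digits-complete 0 (λ n → coeff v (+ n))

  -- A series in k[[z]] is a unit when its constant coefficient is non-zero. Modulo z^(i+1) this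
  -- leaves p choices for that coefficient and q^i for the others.
  representatives-unit : ∀ t i → Representatives (suc t) (suc i) (p ℕ.* q ℕ.^ i)
  representatives-unit t i = representatives (suc t) (suc i) (prepend nonzero (digits i))
    (prepend-separating (λ a b eq → Fin.punchIn-injective (to k.0#) a b (from-injective _ _ eq))
        (digits-separating i))
    (λ x → let s = prepend nonzero (digits i) x in inj₂ (inj₂ (unit {z^ 0ℤ · s} (InPower-z^ 0ℤ s)
      λ z∣s → nonzero≉0 (proj₁ (remQuot (q ℕ.^ i) x))
        (k.trans (k.sym (coeff-z⁰ s 0)) (z∣s 0ℤ (ℤ.+<+ (s≤s z≤n)))))))
    -- The first two cases of `Primitive` would equate a successor with 0.
    λ { v (inj₂ (inj₂ (y , y∈ , vy≈1))) v∈ →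
      prepend-complete {i = i} {nonzero} {digits i} (λ n → coeff v (+ n))
      (nonzero-surjective (coeff v 0ℤ) λ v₀≈0 → unit⇒∉O₁ y∈ vy≈1 (InPower-suc v∈ v₀≈0))
      (digits-complete i (λ n → coeff v (+ suc n))) }

  structureConstant : ∀ (μ : HaarIntegral) {t i N} a → Representatives t i N →
      + (t ℕ.+ i) < a - 1ℤ →
    StructureConstant μ (+ (t ℕ.+ i)) a (a + (+ i - + t)) (+ N ÷ 1)
  structureConstant μ {t} {i} {N} a reps ℓ<a-1 c d c-char d-char =
    integral-counts μ {t} {i} {N} {a} reps ℓ<a-1 c d c-char d-char

-- Exponents and the three cases of the formula

pos-^ : ∀ m n → + (m ℕ.^ n) ≡ (+ m) ^ n
pos-^ m zero    = ≡.refl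
pos-^ m (suc n) = ≡.trans (ℤ.pos-* m (m ℕ.^ n)) (≡.cong (λ x → + m * x) (pos-^ m n))

1≤⇒suc : ∀ {n} → 1ℤ ≤ n → ∃ λ m → n ≡ + suc m
1≤⇒suc (+≤+ {n = suc m} (s≤s z≤n)) = m , ≡.refl

m*2/2≡m : ∀ m → + m * + 2 / + 2 ≡ + m
m*2/2≡m m = ≡.trans (≡.cong (_/ + 2) (≡.sym (ℤ.pos-* m 2)))
  (≡.trans (ℤ.*-identityˡ _) (≡.cong +_ (ℕ.m*n/n≡m m 2)))

-- Solving t + i = ℓ and i - t = j gives t = (ℓ - j)/2 and i = (j + ℓ)/2. The two bounds on j say
-- that both are at least 1, hence the successors.
exponents : ∀ ℓ j → + 2 - ℓ ≤ j → j ≤ ℓ - + 2 → + 2 ∣ ℓ - j →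
  ∃₂ λ t i → ℓ ≡ + (suc t ℕ.+ suc i) × j ≡ + suc i - + suc t × (j + ℓ) / + 2 ≡ + suc i
exponents ℓ j 2-ℓ≤j j≤ℓ-2 2∣ with Signed.∣ᵤ⇒∣ 2∣
... | Signed.divides T ℓ-j≡2T with 1≤⇒suc 1≤T | 1≤⇒suc 1≤I
  where
  I : ℤ
  I = ℓ - T
  ex₁ : ∀ ℓ j → + 2 + (ℓ - + 2 - j) ≡ ℓ - j
  ex₁ = ℤ-Solver.solve-∀
  ex₂ : ∀ ℓ j → + 2 + (j - (+ 2 - ℓ)) ≡ ℓ * + 2 - (ℓ - j)
  ex₂ = ℤ-Solver.solve-∀
  ex₃ : ∀ ℓ T → ℓ * + 2 - T * + 2 ≡ (ℓ - T) * + 2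
  ex₃ = ℤ-Solver.solve-∀
  1≤T : 1ℤ ≤ T
  1≤T = ℤ.*-cancelʳ-≤-pos 1ℤ T (+ 2) (≡.subst (λ x → + 2 ≤ x) (≡.trans (ex₁ ℓ j) ℓ-j≡2T)
    (ℤ.+-monoʳ-≤ (+ 2) (ℤ.i≤j⇒0≤j-i j≤ℓ-2)))
  1≤I : 1ℤ ≤ I
  1≤I = ℤ.*-cancelʳ-≤-pos 1ℤ I (+ 2) (≡.subst (λ x → + 2 ≤ x)
    (≡.trans (ex₂ ℓ j) (≡.trans (≡.cong (λ x → ℓ * + 2 - x) ℓ-j≡2T) (ex₃ ℓ T)))
    (ℤ.+-monoʳ-≤ (+ 2) (ℤ.i≤j⇒0≤j-i 2-ℓ≤j)))
... | t , ≡.refl | i , I≡ = t , i , ℓ≡ , j≡ ,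
    ≡.trans (≡.cong (_/ + 2) (≡.trans (≡.cong₂ _+_ j≡ ℓ≡) (ex₃ (+ suc t) (+ suc i))))
        (m*2/2≡m (suc i))
  where
  ex₁ : ∀ ℓ t → ℓ ≡ t + (ℓ - t)
  ex₁ = ℤ-Solver.solve-∀
  ex₂ : ∀ ℓ j → j ≡ ℓ - (ℓ - j)
  ex₂ = ℤ-Solver.solve-∀
  ex₃ : ∀ t i → i - t + (t + i) ≡ i * + 2
  ex₃ = ℤ-Solver.solve-∀
  ex₄ : ∀ t i → t + i - t * + 2 ≡ i - t
  ex₄ = ℤ-Solver.solve-∀
  ℓ≡ : ℓ ≡ + suc t + + suc i
  ℓ≡ = ≡.trans (ex₁ ℓ (+ suc t)) (≡.cong (λ x → + suc t + x) I≡)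
  j≡ : j ≡ + suc i - + suc t
  j≡ = ≡.trans (ex₂ ℓ j) (≡.trans (≡.cong₂ _-_ ℓ≡ ℓ-j≡2T) (ex₄ (+ suc t) (+ suc i)))

theorem4p2 : ∀ {c e : Level} (k : CommutativeRing c e) (q : ℕ) →
    IsFiniteField k q → CharNot2 k →
    (μ : GL₂k⟮⟮z⟯⟯.HaarIntegral k) (ℓ a : ℤ) → 1ℤ ≤ ℓ → ℓ < a - 1ℤ →
    let h[_]≡_ = λ j → GL₂k⟮⟮z⟯⟯.StructureConstant k μ ℓ a (a + j) in
    (∀ j → + 2 - ℓ ≤ j → j ≤ ℓ - + 2 → + 2 ∣ ℓ - j →
    h[ j ]≡ (((+ q) ^ ∣ (j + ℓ) / + 2 - 1ℤ ∣ * (+ q - 1ℤ)) ÷ 1))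
    × h[ - ℓ ]≡ (1ℤ ÷ 1)
    × h[ ℓ ]≡ (((+ q) ^ ∣ ℓ ∣) ÷ 1)
theorem4p2 k zero kF _ _ _ _ _ _ =
  contradiction (Inverse.to (IsFiniteField.enumeration kF) (CommutativeRing.0# k)) λ ()
theorem4p2 k (suc p) kF 2≉0 μ (+ zero) a (+≤+ ()) ℓ<a-1
theorem4p2 k q@(suc p) kF 2≉0 μ ℓ@(+ suc l) a 1≤ℓ ℓ<a-1 = middle , bottom , top
  where
  open GL₂k⟮⟮z⟯⟯ k using (StructureConstant)
  open StructureConstants k kF 2≉0

  h-resp : ∀ ℓ ℓ′ j j′ h h′ → ℓ ≡ ℓ′ → j ≡ j′ → h ≡ h′ →
    StructureConstant μ ℓ a (a + j) (h ÷ 1) → StructureConstant μ ℓ′ a (a + j′) (h′ ÷ 1)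
  h-resp ℓ _ j _ h _ ≡.refl ≡.refl ≡.refl p = p

  middle : ∀ j → + 2 - ℓ ≤ j → j ≤ ℓ - + 2 → + 2 ∣ ℓ - j →
    StructureConstant μ ℓ a (a + j) (((+ q) ^ ∣ (j + ℓ) / + 2 - 1ℤ ∣ * (+ q - 1ℤ)) ÷ 1)
  middle j 2-ℓ≤j j≤ℓ-2 2∣ = from-exponents (exponents ℓ j 2-ℓ≤j j≤ℓ-2 2∣)
    where
    h′ = (+ q) ^ ∣ (j + ℓ) / + 2 - 1ℤ ∣ * (+ q - 1ℤ)
    from-exponents : (∃₂ λ t i → ℓ ≡ + (suc t ℕ.+ suc i) × j ≡ + suc i - + suc t × (j + ℓ) / + 2 ≡
        + suc i) →
      StructureConstant μ ℓ a (a + j) (h′ ÷ 1)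
    from-exponents (t , i , ℓ≡ , j≡ , i≡) =
      h-resp (+ (suc t ℕ.+ suc i)) ℓ (+ suc i - + suc t) j (+ (p ℕ.* q ℕ.^ i)) h′ (≡.sym ℓ≡)
          (≡.sym j≡)
        -- Since (j + ℓ)/2 = i + 1, the exponent is i, and `+ q - 1ℤ` computes to `+ p`.
        (≡.trans (ℤ.pos-* p (q ℕ.^ i))
            (≡.trans (≡.cong (λ x → + p * x) (pos-^ q i)) (≡.trans (ℤ.*-comm (+ p) _)
          (≡.cong (λ m → (+ q) ^ ∣ m - 1ℤ ∣ * + p) (≡.sym i≡)))))
        (structureConstant μ a (representatives-unit t i) (≡.subst (_< a - 1ℤ) ℓ≡ ℓ<a-1))

  bottom : StructureConstant μ ℓ a (a + - ℓ) (1ℤ ÷ 1)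
  bottom = h-resp (+ (suc l ℕ.+ 0)) ℓ (+ 0 - ℓ) (- ℓ) 1ℤ 1ℤ ℓ+0≡ℓ (ℤ.+-identityˡ (- ℓ)) ≡.refl
    (structureConstant μ a (representatives-i0 (suc l)) (≡.subst (_< a - 1ℤ) (≡.sym ℓ+0≡ℓ) ℓ<a-1))
    where
    ℓ+0≡ℓ : + (suc l ℕ.+ 0) ≡ ℓ
    ℓ+0≡ℓ = ℤ.+-identityʳ ℓ

  top : StructureConstant μ ℓ a (a + ℓ) (((+ q) ^ ∣ ℓ ∣) ÷ 1)
  top = h-resp ℓ ℓ (ℓ - + 0) ℓ (+ (q ℕ.^ suc l)) ((+ q) ^ ∣ ℓ ∣) ≡.refl (ℤ.+-identityʳ ℓ)
      (pos-^ q (suc l))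
    (structureConstant μ a (representatives-t0 (suc l)) ℓ<a-1)
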